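{- There is a polynomial-time algorithm that, given a (finite, simple, nontrivial, connected) bipartite graph $G$, decides whether $rc(G)=2$.
   Context: For a nontrivial connected graph $G$ and an edge-coloring of $G$ (adjacent edges may receive the same color), a path is a rainbow path if no two of its edges have the same color. $G$ is rainbow connected with respect to the coloring if every two vertices $u,v$ are joined by a rainbow $u$–$v$ path. The rainbow connection number $rc(G)$ is the smallest number of colors needed in an edge-coloring making $G$ rainbow connected. -}

module Defs where

open import Data.Nat using (ℕ; zero; suc; _+_; _*_; _^_; _<_; _≤_)
open import Data.Fin using (Fin; zero; suc)
open import Data.Bool using (Bool; true; false; T)
open import Data.List using (List; []; _∷_; head; last; map; concatMap; allFin; length)
open import Data.List.Relation.Unary.Unique.Propositional using (Unique)
open import Data.Maybe using (Maybe; just; nothing)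
open import Data.Product using (Σ; ∃; _×_; _,_)
open import Data.Sum using (_⊎_; inj₁; inj₂)
open import Data.Unit using (⊤)
open import Relation.Nullary using (¬_)
open import Relation.Binary.PropositionalEquality using (_≡_; _≢_)

record Graph : Set where
  field
    n      : ℕ
    adj    : Fin n → Fin n → Bool
    symm   : ∀ u v → adj u v ≡ adj v u
    irrefl : ∀ u → adj u u ≡ false

module _ (G : Graph) where
  open Graph G

  Adj : Fin n → Fin n → Set
  Adj u v = T (adj u v)

  Linked : List (Fin n) → Set
  Linked []           = ⊤
  Linked (x ∷ [])     = ⊤
  Linked (x ∷ y ∷ r)  = Adj x y × Linked (y ∷ r)

  IsPath : Fin n → Fin n → List (Fin n) → Set
  IsPath u v vs = head vs ≡ just u × last vs ≡ just v × Linked vs × Unique vs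

  Connected : Set
  Connected = ∀ u v → ∃ λ vs → IsPath u v vs

  Nontrivial : Set
  Nontrivial = 2 ≤ n

  Bipartite : Set
  Bipartite = Σ (Fin n → Bool) λ side → ∀ u v → Adj u v → side u ≢ side v

  -- an edge-colouring with (at most) k colours; only the values on
  -- edges matter, and an edge gets one colour regardless of orientation
  record Colouring (k : ℕ) : Set where
    field
      col    : Fin n → Fin n → Fin k
      colSym : ∀ u v → Adj u v → col u v ≡ col v u

  edgeColours : ∀ {k} → Colouring k → List (Fin n) → List (Fin k)
  edgeColours c []          = []
  edgeColours c (x ∷ [])    = []
  edgeColours c (x ∷ y ∷ r) = Colouring.col c x y ∷ edgeColours c (y ∷ r)

  RainbowPath : ∀ {k} → Colouring k → Fin n → Fin n → List (Fin n) → Set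
  RainbowPath c u v vs = IsPath u v vs × Unique (edgeColours c vs)

  RainbowConnected : ∀ {k} → Colouring k → Set
  RainbowConnected c = ∀ u v → ∃ λ vs → RainbowPath c u v vs

  RCWith : ℕ → Set
  RCWith k = Σ (Colouring k) RainbowConnected

  rc≡ : ℕ → Set
  rc≡ m = RCWith m × (∀ k → k < m → ¬ RCWith k)

-- Deterministic single-tape Turing machines (bi-infinite tape)
-- Tape alphabet Fin (3 + s): zero = blank, 1 = input bit 0, 2 = input bit 1.

data Move : Set where
  left right stay : Move

record TM : Set where
  field
    states : ℕ
    syms   : ℕ
    -- halt with a Boolean answer, or (new state, written symbol, move)
    δ : Fin (suc states) → Fin (suc (suc (suc syms))) →
        Bool ⊎ (Fin (suc states) × Fin (suc (suc (suc syms))) × Move)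

module _ (M : TM) where
  open TM M

  Sym : Set
  Sym = Fin (suc (suc (suc syms)))

  blank : Sym
  blank = zero

  record Config : Set where
    constructor cfg
    field
      state : Fin (suc states)
      lft   : List Sym   -- cells left of head, nearest first
      hd    : Sym
      rgt   : List Sym   -- cells right of head, nearest first

  shift : Move → List Sym → Sym → List Sym → (List Sym × Sym × List Sym)
  shift left  []      h r = [] , blank , h ∷ r
  shift left  (x ∷ l) h r = l , x , h ∷ r
  shift right l h []      = h ∷ l , blank , []
  shift right l h (x ∷ r) = h ∷ l , x , r
  shift stay  l h r       = l , h , r

  run : ℕ → Config → Maybe Bool
  run zero _ = nothing
  run (suc f) (cfg q l h r) with δ q h
  ... | inj₁ b = just b
  ... | inj₂ (q' , w , m) with shift m l w r
  ...   | (l' , h' , r') = run f (cfg q' l' h' r')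

  bitSym : Bool → Sym
  bitSym false = suc zero
  bitSym true  = suc (suc zero)

  initial : List Bool → Config
  initial []       = cfg zero [] blank []
  initial (b ∷ bs) = cfg zero [] (bitSym b) (map bitSym bs)

encode : Graph → List Bool
encode G = concatMap (λ u → map (λ v → adj u v) (allFin n)) (allFin n)
  where open Graph G

{-# OPTIONS --safe #-}
module Submission where

-- A rainbow path in two colours has at most two edges, so a bipartite G with rc(G) = 2 is complete
-- bipartite: with r the row of vertex 0 in the adjacency matrix, adj u v = r u xor r v. Let s and t be
-- the numbers of zeros and ones of r. A 2-colouring of K_{s,t} is an s × t binary matrix, and it is
-- rainbow connecting iff its rows are distinct and its columns are distinct. Such a matrix exists iff
-- t ≤ 2^s and s ≤ 2^t: start from an identity matrix and keep adding rows not yet present. Excluding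
-- the single edge (n = 2), these conditions characterise rc(G) = 2.
--
-- They are tested by a program on registers with values in {0,…,L}, L = n² the input length. A register
-- is a pebble on the tape, every instruction is one sweep over the tape, and since the only loops are
-- "for i < L", running times are polynomial by construction.

open import Defs
open import Data.Bool using (Bool; true; false; _∧_; _∨_; _xor_; not; if_then_else_; T)
open import Data.Bool.Properties using (∨-identityʳ; xor-same)
open import Data.Empty using (⊥; ⊥-elim)
open import Data.Fin using (Fin; zero; suc; #_; toℕ; fromℕ<; splitAt; join; combine; remQuot; funToFin; finToFun)
import Data.Fin as Fin
open import Data.Fin.Properties using (splitAt-join; remQuot-combine; toℕ-injective; toℕ-fromℕ<; toℕ-cast; toℕ<n; any?; all?; ¬∀⟶∃¬; injective⇒≤; finToFun-funToFin; funToFin-finToFin)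
open import Data.List using (List; []; _∷_; length; _++_; _ʳ++_; tabulate; concatMap; allFin)
import Data.List as List
open import Data.List.Properties using (length-++; length-map; length-tabulate)
open import Data.List.Relation.Unary.All using ([]; _∷_)
open import Data.List.Relation.Unary.AllPairs using ([]; _∷_)
open import Data.Maybe using (Maybe; just; nothing; fromMaybe; maybe)
open import Data.Nat using (ℕ; zero; suc; _+_; _*_; _^_; _⊓_; _≡ᵇ_; _≤_; _<_; z≤n; s≤s; _<?_; _≟_)
open import Data.Nat.Properties
open import Data.Nat.Solver using (module +-*-Solver)
open import Data.Product using (Σ; ∃; _×_; _,_; proj₁; proj₂)
import Data.Product as Product
open import Data.Sum using (_⊎_; inj₁; inj₂)
import Data.Sum as Sum
open import Data.Unit using (⊤; tt)
open import Data.Vec using (Vec; []; _∷_; lookup; map; replicate; _[_]≔_)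
open import Data.Vec.Properties using (lookup-map; map-[]≔; map-replicate; lookup∘update; lookup∘update′; lookup-replicate)
open import Function using (_∘_; id)
open import Relation.Binary.Definitions using (tri<; tri≈; tri>)
open import Relation.Binary.PropositionalEquality using (_≡_; _≢_; refl; sym; trans; cong; cong₂; subst; subst₂; module ≡-Reasoning)
open import Relation.Nullary using (Dec; yes; no; ¬_)
open import Relation.Nullary.Decidable using (False; toWitnessFalse)
open +-*-Solver using (solve; _:+_; _:*_; _:=_; con)

-- Sweeping Turing machines

-- The input is a bare string of `n * n` bits without delimiters, so `n` has to be found. Each
-- `k < L` is tried as row length; reading the matrix with rows of length `k` ends at the start of
-- row `k` exactly when `k * k = L`. Row 0 opens the input, so one instruction reads both matrix
-- entries and the values of `r`.
--
-- The powers of two may exceed every value that a register can hold. They are built by doubling and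
-- capped at `L`, which does no harm: they are only compared with `s` and `t`, and these are at most
-- `n < L`.
--
-- The single edge needs a test of its own because `s = t = 1` satisfies both inequalities although
-- one colour suffices.
--
-- A sweep returns the head to the left border, so every instruction starts from the same head
-- position. Composing programs is then a matter of wiring flowchart nodes, and only one bit has to
-- survive from a sweep to the choice of its successor.

record Finite (A : Set) : Set where
  field
    size    : ℕ
    enc     : A → Fin size
    dec     : Fin size → A
    dec-enc : ∀ a → dec (enc a) ≡ a

open Finite

finite-⊤ : Finite ⊤
finite-⊤ = record { size = 1 ; enc = λ _ → zero ; dec = λ _ → tt ; dec-enc = λ _ → refl }

finite-⊎ : ∀ {A B} → Finite A → Finite B → Finite (A ⊎ B)
finite-⊎ {A} {B} F G = record
  { size = size F + size G
  ; enc = join (size F) (size G) ∘ Sum.map (enc F) (enc G)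
  ; dec = Sum.map (dec F) (dec G) ∘ splitAt (size F)
  ; dec-enc = λ x → trans (cong (Sum.map (dec F) (dec G)) (splitAt-join (size F) (size G) (Sum.map (enc F) (enc G) x))) (back x)
  }
  where
  back : ∀ x → Sum.map (dec F) (dec G) (Sum.map (enc F) (enc G) x) ≡ x
  back (inj₁ a) = cong inj₁ (dec-enc F a)
  back (inj₂ b) = cong inj₂ (dec-enc G b)

finite-× : ∀ {A B} → Finite A → Finite B → Finite (A × B)
finite-× F G = record
  { size = size F * size G
  ; enc = λ (a , b) → combine (enc F a) (enc G b)
  ; dec = Product.map (dec F) (dec G) ∘ remQuot (size G)
  ; dec-enc = λ (a , b) → trans (cong (Product.map (dec F) (dec G)) (remQuot-combine (enc F a) (enc G b)))
                                (cong₂ _,_ (dec-enc F a) (dec-enc G b))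
  }

finite-retract : ∀ {A B : Set} (f : A → B) (g : B → A) → (∀ a → g (f a) ≡ a) → Finite B → Finite A
finite-retract f g gf F = record
  { size = size F ; enc = enc F ∘ f ; dec = g ∘ dec F
  ; dec-enc = λ a → trans (cong g (dec-enc F (f a))) (gf a) }

finite-Bool : Finite Bool
finite-Bool = finite-retract {B = ⊤ ⊎ ⊤}
  (λ { false → inj₁ tt ; true → inj₂ tt }) (λ { (inj₁ _) → false ; (inj₂ _) → true })
  (λ { false → refl ; true → refl }) (finite-⊎ finite-⊤ finite-⊤)

finite-Maybe : ∀ {A} → Finite A → Finite (Maybe A)
finite-Maybe {A} F = finite-retract {B = ⊤ ⊎ A}
  (λ { nothing → inj₁ tt ; (just a) → inj₂ a }) (λ { (inj₁ _) → nothing ; (inj₂ a) → just a })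
  (λ { nothing → refl ; (just _) → refl }) (finite-⊎ finite-⊤ F)

finite-Vec : ∀ {A} → Finite A → ∀ n → Finite (Vec A n)
finite-Vec F zero = finite-retract (λ _ → tt) (λ _ → []) (λ { [] → refl }) finite-⊤
finite-Vec {A} F (suc n) = finite-retract {B = A × Vec A n}
  (λ { (x ∷ xs) → x , xs }) (λ (x , xs) → x ∷ xs) (λ { (x ∷ xs) → refl }) (finite-× F (finite-Vec F n))

-- Unconverted input bits are kept apart from working cells, and blanks are never cells, so a sweep
-- can recognise both ends of the working area.
data Letter (C : Set) : Set where
  blk  : Letter C
  raw  : Bool → Letter C
  cell : C → Letter C

module Machine {Q C : Set} (FQ : Finite Q) (FC : Finite C)
  (start : Q) (step : Q → Letter C → Bool ⊎ (Q × Letter C × Move)) where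

  -- State zero is an extra copy of start, because runs begin in state zero.
  encQ : Q → Fin (suc (size FQ))
  encQ q = suc (enc FQ q)

  decQ : Fin (suc (size FQ)) → Q
  decQ zero    = start
  decQ (suc q) = dec FQ q

  encS : Letter C → Fin (suc (suc (suc (size FC))))
  encS blk         = zero
  encS (raw false) = suc zero
  encS (raw true)  = suc (suc zero)
  encS (cell c)    = suc (suc (suc (enc FC c)))

  decS : Fin (suc (suc (suc (size FC)))) → Letter C
  decS zero                = blk
  decS (suc zero)          = raw false
  decS (suc (suc zero))    = raw true
  decS (suc (suc (suc c))) = cell (dec FC c)

  decS-encS : ∀ a → decS (encS a) ≡ a
  decS-encS blk         = refl
  decS-encS (raw false) = refl
  decS-encS (raw true)  = refl
  decS-encS (cell c)    = cong cell (dec-enc FC c)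

  code : Bool ⊎ (Q × Letter C × Move) → Bool ⊎ (Fin (suc (size FQ)) × Fin (suc (suc (suc (size FC)))) × Move)
  code (inj₁ b)           = inj₁ b
  code (inj₂ (q , a , m)) = inj₂ (encQ q , encS a , m)

  machine : TM
  machine = record { states = size FQ ; syms = size FC ; δ = λ q a → code (step (decQ q) (decS a)) }

  record Conf : Set where
    constructor conf
    field
      state  : Q
      before : List (Letter C)
      here   : Letter C
      after  : List (Letter C)

  goR goL : Q → List (Letter C) → List (Letter C) → Conf
  goR q l []      = conf q l blk []
  goR q l (x ∷ r) = conf q l x r
  goL q [] r      = conf q [] blk r
  goL q (x ∷ l) r = conf q l x r

  move : Move → Q → List (Letter C) → Letter C → List (Letter C) → Conf
  move left  q l a r = goL q l (a ∷ r)
  move right q l a r = goR q (a ∷ l) r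
  move stay  q l a r = conf q l a r

  exec : ℕ → Conf → Maybe Bool
  execStep : ℕ → Bool ⊎ (Q × Letter C × Move) → List (Letter C) → List (Letter C) → Maybe Bool
  exec zero    _              = nothing
  exec (suc f) (conf q l a r) = execStep f (step q a) l r
  execStep f (inj₁ b)           l r = just b
  execStep f (inj₂ (q , a , m)) l r = exec f (move m q l a r)

  -- The machine state is constrained only through `decQ`, so that the initial state `zero` and the
  -- codes `encQ q` are covered by the same induction.
  run≡exec : ∀ f q' q l a r → decQ q' ≡ q →
             run machine f (cfg q' (List.map encS l) (encS a) (List.map encS r)) ≡ exec f (conf q l a r)
  run≡exec zero q' q l a r e = refl
  run≡exec (suc f) q' q l a r refl rewrite decS-encS a with step (decQ q') a
  ... | inj₁ b = refl
  ... | inj₂ (p , w , stay)  = run≡exec f _ p l w r (dec-enc FQ p)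
  run≡exec (suc f) q' q [] a r refl | inj₂ (p , w , left) =
    run≡exec f _ p [] blk (w ∷ r) (dec-enc FQ p)
  run≡exec (suc f) q' q (x ∷ l) a r refl | inj₂ (p , w , left) =
    run≡exec f _ p l x (w ∷ r) (dec-enc FQ p)
  run≡exec (suc f) q' q l a [] refl | inj₂ (p , w , right) =
    run≡exec f _ p (w ∷ l) blk [] (dec-enc FQ p)
  run≡exec (suc f) q' q l a (x ∷ r) refl | inj₂ (p , w , right) =
    run≡exec f _ p (w ∷ l) x r (dec-enc FQ p)

  -- Quantifying over the remaining fuel makes stretches of a run compose by `trans`, with exact
  -- step counts.
  _⟶[_]_ : Conf → ℕ → Conf → Set
  c ⟶[ k ] d = ∀ f → exec (k + f) c ≡ exec f d

  run-raw : ∀ f b bs → run machine f (initial machine (b ∷ bs)) ≡ exec f (conf start [] (raw b) (List.map raw bs))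
  run-raw f b bs = trans (cong₂ (λ x y → run machine f (cfg zero [] x y)) (bit b) (bits bs))
                         (run≡exec f zero start [] (raw b) (List.map raw bs) refl)
    where
    bit : ∀ b → bitSym machine b ≡ encS (raw b)
    bit false = refl
    bit true  = refl
    bits : ∀ bs → List.map (bitSym machine) bs ≡ List.map encS (List.map raw bs)
    bits []       = refl
    bits (b ∷ bs) = cong₂ _∷_ (bit b) (bits bs)

-- Sweeps with one carried bit, and flowcharts of sweeps as machines

record Sweep (C : Set) : Set where
  constructor sweep
  field
    init : Bool
    turn : Bool → C → Bool × C

open Sweep

sweepList : ∀ {C : Set} → (Bool → C → Bool × C) → Bool → List C → Bool × List C
sweepList f c []       = c , []
sweepList f c (x ∷ xs) =
  let (c' , x') = f c x ; (c″ , xs') = sweepList f c' xs in c″ , x' ∷ xs'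

length-sweepList : ∀ {C : Set} f c (xs : List C) → length (proj₂ (sweepList f c xs)) ≡ length xs
length-sweepList f c []       = refl
length-sweepList f c (x ∷ xs) = cong suc (length-sweepList f _ xs)

-- `convert`, `edge` and `rewind` prepare the tape. Afterwards a node computes in `fwd` and carries
-- its final bit back to the left border in `bwd`. In `step` below, the extra state `nothing` reads
-- the first input bit.
data Ctrl (N : Set) : Set where
  convert edge rewind : Ctrl N
  fwd bwd             : N → Bool → Ctrl N

finite-Ctrl : ∀ {N} → Finite N → Finite (Ctrl N)
finite-Ctrl {N} F = finite-retract {B = Maybe (Maybe (Maybe (N × Bool ⊎ N × Bool)))}
  (λ { convert → nothing ; edge → just nothing ; rewind → just (just nothing)
     ; (fwd n c) → just (just (just (inj₁ (n , c)))) ; (bwd n c) → just (just (just (inj₂ (n , c)))) })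
  (λ { nothing → convert ; (just nothing) → edge ; (just (just nothing)) → rewind
     ; (just (just (just (inj₁ (n , c))))) → fwd n c ; (just (just (just (inj₂ (n , c))))) → bwd n c })
  (λ { convert → refl ; edge → refl ; rewind → refl ; (fwd _ _) → refl ; (bwd _ _) → refl })
  (finite-Maybe (finite-Maybe (finite-Maybe (finite-⊎ (finite-× F finite-Bool) (finite-× F finite-Bool)))))

-- A flowchart whose nodes are sweeps over the tape cells; the Boolean a sweep ends in selects the successor.
record Flow (C : Set) : Set₁ where
  field
    Node  : Set
    fin   : Finite Node
    entry : Node
    act   : Node → Sweep C
    next  : Node → Bool → Node ⊎ Bool

module Sweeping {C : Set} (FC : Finite C) (F : Flow C) (first rest : Bool → C) (end : C) where
  open Flow F

  enter : Node ⊎ Bool → Bool ⊎ (Maybe (Ctrl Node) × Letter C × Move)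
  enter (inj₁ n) = inj₂ (just (fwd n (init (act n))) , blk , right)
  enter (inj₂ b) = inj₁ b

  step : Maybe (Ctrl Node) → Letter C → Bool ⊎ (Maybe (Ctrl Node) × Letter C × Move)
  step nothing (raw b)            = inj₂ (just convert , cell (first b) , right)
  step (just convert) (raw b)     = inj₂ (just convert , cell (rest b) , right)
  step (just convert) blk         = inj₂ (just edge , cell end , right)
  step (just edge) blk            = inj₂ (just rewind , blk , left)
  step (just rewind) (cell x)     = inj₂ (just rewind , cell x , left)
  step (just rewind) blk          = enter (inj₁ entry)
  step (just (fwd n c)) (cell x)  =
    inj₂ (just (fwd n (proj₁ (turn (act n) c x))) , cell (proj₂ (turn (act n) c x)) , right)
  step (just (fwd n c)) blk       = inj₂ (just (bwd n c) , blk , left)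
  step (just (bwd n c)) (cell x)  = inj₂ (just (bwd n c) , cell x , left)
  step (just (bwd n c)) blk       = enter (next n c)
  -- No run on a nonempty input reaches these combinations; the answer is arbitrary.
  step _ _                        = inj₁ false

  open Machine (finite-Maybe (finite-Ctrl fin)) FC nothing step public

  home : Node → List C → Conf
  home n xs = goR (just (fwd n (init (act n)))) (blk ∷ []) (List.map cell xs ++ blk ∷ [])

  forward : ∀ n xs c l → goR (just (fwd n c)) l (List.map cell xs ++ blk ∷ []) ⟶[ length xs ]
              conf (just (fwd n (proj₁ (sweepList (turn (act n)) c xs))))
                   (List.map cell (proj₂ (sweepList (turn (act n)) c xs)) ʳ++ l) blk []
  forward n []       c l f = refl
  forward n (x ∷ xs) c l f = forward n xs _ _ f

  backward : ∀ q → (∀ x → step q (cell x) ≡ inj₂ (q , cell x , left)) → ∀ xs l r →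
             goL q (List.map cell xs ʳ++ l) r ⟶[ length xs ] goL q l (List.map cell xs ++ r)
  backward q h []       l r f = refl
  backward q h (x ∷ xs) l r f =
    trans (cong (λ z → exec z (goL q (List.map cell xs ʳ++ (cell x ∷ l)) r)) (sym (+-suc (length xs) f)))
    (trans (backward q h xs (cell x ∷ l) r (suc f))
           (cong (λ z → execStep f z l (List.map cell xs ++ r)) (h x)))

  -- Forward over `m` cells, a turn on the right blank, back over `m` cells, and the step on the
  -- left blank that enters the next node.
  roundtrip : ℕ → ℕ
  roundtrip m = m + (1 + (m + 1))

  module _ (n : Node) (xs : List C) where
    private
      c  = proj₁ (sweepList (turn (act n)) (init (act n)) xs)
      ys = proj₂ (sweepList (turn (act n)) (init (act n)) xs)

    round : ∀ f → exec (roundtrip (length xs) + f) (home n xs)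
                ≡ execStep f (enter (next n c)) [] (List.map cell ys ++ blk ∷ [])
    round f =
      trans (cong (λ z → exec z (home n xs)) arith)
      (trans (forward n xs _ _ (1 + (length ys + suc f)))
             (backward (just (bwd n c)) (λ _ → refl) ys (blk ∷ []) (blk ∷ []) (suc f)))
      where
      arith : roundtrip (length xs) + f ≡ length xs + (1 + (length ys + suc f))
      arith rewrite length-sweepList (turn (act n)) (init (act n)) xs =
        solve 2 (λ m f → m :+ (con 1 :+ (m :+ con 1)) :+ f := m :+ (con 1 :+ (m :+ (con 1 :+ f)))) refl (length xs) f

  -- Here `m` counts the bits after the first one: `1 + m` steps convert the input, three append the
  -- end cell and turn around, `m + 1` rewind, and one enters the flowchart.
  bootTime : ℕ → ℕ
  bootTime m = m + m + 6

  boot : ∀ b bs → conf nothing [] (raw b) (List.map raw bs) ⟶[ bootTime (length bs) ]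
           home entry (first b ∷ List.map rest bs ++ end ∷ [])
  boot b bs f =
    trans (cong (λ z → exec z (conf nothing [] (raw b) (List.map raw bs))) arith)
    (trans (converting bs (cell (first b) ∷ []) (3 + (length zs + (1 + f))))
    (trans (backward (just rewind) (λ _ → refl) zs [] (cell end ∷ blk ∷ []) (1 + f))
           (cong (λ z → exec f (goR (just (fwd entry (init (act entry)))) (blk ∷ []) z)) (snoc zs))))
    where
    zs = first b ∷ List.map rest bs
    converting : ∀ bs l → goR (just convert) l (List.map raw bs) ⟶[ length bs ]
                   conf (just convert) (List.map cell (List.map rest bs) ʳ++ l) blk []
    converting []       l f = refl
    converting (b ∷ bs) l f = converting bs _ f
    snoc : ∀ zs → List.map cell zs ++ cell end ∷ blk ∷ [] ≡ List.map cell (zs ++ end ∷ []) ++ blk ∷ []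
    snoc []       = refl
    snoc (z ∷ zs) = cong (cell z ∷_) (snoc zs)
    arith : bootTime (length bs) + f ≡ 1 + (length bs + (3 + (length zs + (1 + f))))
    arith rewrite length-map rest bs =
      solve 2 (λ m f → m :+ m :+ con 6 :+ f := con 1 :+ (m :+ (con 3 :+ ((con 1 :+ m) :+ (con 1 :+ f))))) refl (length bs) f

  exec-mono : ∀ {f c b} g → exec f c ≡ just b → exec (f + g) c ≡ just b
  exec-mono {suc f} {conf q l a r} g e with step q a
  ... | inj₁ _           = e
  ... | inj₂ (p , w , m) = exec-mono {f} g e

≡ᵇ-refl : ∀ m → (m ≡ᵇ m) ≡ true
≡ᵇ-refl zero    = refl
≡ᵇ-refl (suc m) = ≡ᵇ-refl m

≢⇒≡ᵇ-false : ∀ m n → m ≢ n → (m ≡ᵇ n) ≡ false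
≢⇒≡ᵇ-false m n m≢n with m ≡ᵇ n in e
... | false = refl
... | true  = ⊥-elim (m≢n (≡ᵇ⇒≡ m n (subst T (sym e) tt)))

-- Polynomially bounded functions

-- The base `suc L` is positive, so exponents may be raised freely; `poly-+` and `poly-*` can then
-- both use `d + d'`.
Poly : (ℕ → ℕ) → Set
Poly f = Σ ℕ λ c → Σ ℕ λ d → ∀ L → f L ≤ c * suc L ^ d

poly-const : ∀ k → Poly (λ _ → k)
poly-const k = k , 0 , λ L → ≤-reflexive (sym (*-identityʳ k))

poly-id : Poly (λ L → L)
poly-id = 1 , 1 , λ L → ≤-trans (n≤1+n L) (≤-reflexive (sym (trans (*-identityˡ _) (*-identityʳ (suc L)))))

poly-+ : ∀ {f g} → Poly f → Poly g → Poly (λ L → f L + g L)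
poly-+ {f} {g} (c , d , p) (c' , d' , p') = c + c' , d + d' , λ L → begin
  f L + g L                                          ≤⟨ +-mono-≤ (p L) (p' L) ⟩
  c * suc L ^ d + c' * suc L ^ d'                    ≤⟨ +-mono-≤ (*-monoʳ-≤ c (^-monoʳ-≤ (suc L) (m≤m+n d d')))
                                                                 (*-monoʳ-≤ c' (^-monoʳ-≤ (suc L) (m≤n+m d' d))) ⟩
  c * suc L ^ (d + d') + c' * suc L ^ (d + d')       ≡⟨ sym (*-distribʳ-+ (suc L ^ (d + d')) c c') ⟩
  (c + c') * suc L ^ (d + d')                        ∎
  where open ≤-Reasoning

poly-* : ∀ {f g} → Poly f → Poly g → Poly (λ L → f L * g L)
poly-* {f} {g} (c , d , p) (c' , d' , p') = c * c' , d + d' , λ L → begin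
  f L * g L                                ≤⟨ *-mono-≤ (p L) (p' L) ⟩
  (c * suc L ^ d) * (c' * suc L ^ d')      ≡⟨ solve 4 (λ a b x y → (a :* x) :* (b :* y) := (a :* b) :* (x :* y)) refl c c' (suc L ^ d) (suc L ^ d') ⟩
  c * c' * (suc L ^ d * suc L ^ d')        ≡⟨ cong (c * c' *_) (sym (^-distribˡ-+-* (suc L) d d')) ⟩
  c * c' * suc L ^ (d + d')                ∎
  where open ≤-Reasoning

-- Register programs

iter : ∀ {A : Set} → ℕ → (A → A) → A → A
iter zero    f x = x
iter (suc k) f x = iter k f (f x)

at : List Bool → ℕ → Maybe Bool
at []       _       = nothing
at (b ∷ bs) zero    = just b
at (b ∷ bs) (suc p) = at bs p

nth : List Bool → ℕ → Bool
nth bs p = fromMaybe false (at bs p)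

data Op (R : ℕ) : Set where
  inc clr : Fin R → Op R
  eq      : Fin R → Fin R → Op R
  bit     : Fin R → Op R

infixr 5 _⨾_

data Prog (R : ℕ) : Set where
  op   : Op R → Prog R
  ite  : Op R → Prog R → Prog R → Prog R
  _⨾_  : Prog R → Prog R → Prog R
  loop : Fin R → Prog R → Prog R

module Semantics {R : ℕ} (bs : List Bool) where

  L : ℕ
  L = length bs

  -- The Boolean of `inc` tells whether the saturating increment has arrived at `L`; it is the exit
  -- test of a compiled loop.
  eval : Op R → Vec ℕ R → Bool × Vec ℕ R
  eval (inc i)  σ = ((suc (lookup σ i) ⊓ L) ≡ᵇ L) , σ [ i ]≔ (suc (lookup σ i) ⊓ L)
  eval (clr i)  σ = false , σ [ i ]≔ 0
  eval (eq i j) σ = (lookup σ i ≡ᵇ lookup σ j) , σ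
  eval (bit i)  σ = nth bs (lookup σ i) , σ

  sem : Prog R → Vec ℕ R → Vec ℕ R
  sem (op o) σ      = proj₂ (eval o σ)
  sem (ite o p q) σ = if proj₁ (eval o σ) then sem p (proj₂ (eval o σ)) else sem q (proj₂ (eval o σ))
  sem (p ⨾ q) σ     = sem q (sem p σ)
  sem (loop i p) σ  = iter L (λ τ → proj₂ (eval (inc i) (sem p τ))) (σ [ i ]≔ 0)

module _ {R : ℕ} where

  -- A syntactic condition that computes to unit types on a concrete program, so its proof is found
  -- by `_`.
  Avoids : Fin R → Prog R → Set
  AvoidsOp : Fin R → Op R → Set
  AvoidsOp i (inc j)  = False (i Fin.≟ j)
  AvoidsOp i (clr j)  = False (i Fin.≟ j)
  AvoidsOp i (eq _ _) = ⊤
  AvoidsOp i (bit _)  = ⊤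
  Avoids i (op o)      = AvoidsOp i o
  Avoids i (ite o p q) = AvoidsOp i o × Avoids i p × Avoids i q
  Avoids i (p ⨾ q)     = Avoids i p × Avoids i q
  Avoids i (loop j p)  = False (i Fin.≟ j) × Avoids i p

  WellFormed : Prog R → Set
  WellFormed (op _)      = ⊤
  WellFormed (ite _ p q) = WellFormed p × WellFormed q
  WellFormed (p ⨾ q)     = WellFormed p × WellFormed q
  WellFormed (loop i p)  = Avoids i p × WellFormed p

  module _ (bs : List Bool) where
    open Semantics {R} bs

    eval-avoids : ∀ i o → AvoidsOp i o → ∀ σ → lookup (proj₂ (eval o σ)) i ≡ lookup σ i
    eval-avoids i (inc j)  a σ = lookup∘update′ (toWitnessFalse a) σ _
    eval-avoids i (clr j)  a σ = lookup∘update′ (toWitnessFalse a) σ _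
    eval-avoids i (eq _ _) a σ = refl
    eval-avoids i (bit _)  a σ = refl

    sem-avoids : ∀ i p → Avoids i p → ∀ σ → lookup (sem p σ) i ≡ lookup σ i
    sem-avoids i (op o) a σ = eval-avoids i o a σ
    sem-avoids i (ite o p q) (a , b , c) σ with proj₁ (eval o σ)
    ... | true  = trans (sem-avoids i p b _) (eval-avoids i o a σ)
    ... | false = trans (sem-avoids i q c _) (eval-avoids i o a σ)
    sem-avoids i (p ⨾ q) (a , b) σ = trans (sem-avoids i q b _) (sem-avoids i p a σ)
    sem-avoids i (loop j p) (i≢j , a) σ =
      trans (go L (σ [ j ]≔ 0)) (lookup∘update′ (toWitnessFalse i≢j) σ 0)
      where
      go : ∀ k τ → lookup (iter k (λ τ → proj₂ (eval (inc j) (sem p τ))) τ) i ≡ lookup τ i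
      go zero    τ = refl
      go (suc k) τ = trans (go k _) (trans (lookup∘update′ (toWitnessFalse i≢j) (sem p τ) _) (sem-avoids i p a τ))

  -- Compilation to flowcharts; a missing target means leaving the program.

  Node : Prog R → Set
  Node (op _)      = ⊤
  Node (ite _ p q) = Maybe (Node p ⊎ Node q)
  Node (p ⨾ q)     = Node p ⊎ Node q
  Node (loop _ p)  = Maybe (Maybe (Node p))

  finite-Node : ∀ p → Finite (Node p)
  finite-Node (op _)      = finite-⊤
  finite-Node (ite _ p q) = finite-Maybe (finite-⊎ (finite-Node p) (finite-Node q))
  finite-Node (p ⨾ q)     = finite-⊎ (finite-Node p) (finite-Node q)
  finite-Node (loop _ p)  = finite-Maybe (finite-Maybe (finite-Node p))

  entry : ∀ p → Node p
  entry (op _)      = tt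
  entry (ite _ _ _) = nothing
  entry (p ⨾ _)     = inj₁ (entry p)
  entry (loop _ _)  = nothing

  opAt : ∀ p → Node p → Op R
  opAt (op o) _                     = o
  opAt (ite o _ _) nothing          = o
  opAt (ite _ p _) (just (inj₁ a))  = opAt p a
  opAt (ite _ _ q) (just (inj₂ a))  = opAt q a
  opAt (p ⨾ _) (inj₁ a)             = opAt p a
  opAt (_ ⨾ q) (inj₂ a)             = opAt q a
  opAt (loop i _) nothing           = clr i
  opAt (loop i _) (just nothing)    = inc i
  opAt (loop _ p) (just (just a))   = opAt p a

  redirect : {A B : Set} → (A → B) → Maybe B → Maybe A → Maybe B
  redirect f e = maybe (just ∘ f) e

  goto : ∀ p → Node p → Bool → Maybe (Node p)
  goto (op _) _ _                      = nothing
  goto (ite _ p q) nothing b           = just (just (if b then inj₁ (entry p) else inj₂ (entry q)))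
  goto (ite _ p q) (just (inj₁ a)) b   = redirect (just ∘ inj₁) nothing (goto p a b)
  goto (ite _ p q) (just (inj₂ a)) b   = redirect (just ∘ inj₂) nothing (goto q a b)
  goto (p ⨾ q) (inj₁ a) b              = redirect inj₁ (just (inj₂ (entry q))) (goto p a b)
  goto (p ⨾ q) (inj₂ a) b              = redirect inj₂ nothing (goto q a b)
  goto (loop i p) nothing b            = just (just (just (entry p)))
  goto (loop i p) (just nothing) true  = nothing
  goto (loop i p) (just nothing) false = just (just (just (entry p)))
  goto (loop i p) (just (just a)) b    = redirect (just ∘ just) (just (just nothing)) (goto p a b)

  -- A bound on the number of instructions, not of tape steps. Adding both branches of `ite` keeps
  -- it within sums and products.
  cost : Prog R → ℕ → ℕ
  cost (op _) L      = 1
  cost (ite _ p q) L = 1 + (cost p L + cost q L)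
  cost (p ⨾ q) L     = cost p L + cost q L
  cost (loop _ p) L  = 1 + L * (cost p L + 1)

  poly-cost : ∀ p → Poly (cost p)
  poly-cost (op _)      = poly-const 1
  poly-cost (ite _ p q) = poly-+ (poly-const 1) (poly-+ (poly-cost p) (poly-cost q))
  poly-cost (p ⨾ q)     = poly-+ (poly-cost p) (poly-cost q)
  poly-cost (loop _ p)  = poly-+ (poly-const 1) (poly-* poly-id (poly-+ (poly-cost p) (poly-const 1)))

  module _ (bs : List Bool) where
    open Semantics {R} bs

    data Steps (p : Prog R) : Maybe (Node p) → Vec ℕ R → ℕ → Maybe (Node p) → Vec ℕ R → Set where
      done : ∀ {m σ} → Steps p m σ 0 m σ
      step : ∀ {a σ k m τ} →
             Steps p (goto p a (proj₁ (eval (opAt p a) σ))) (proj₂ (eval (opAt p a) σ)) k m τ →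
             Steps p (just a) σ (suc k) m τ

    steps-trans : ∀ {p m σ j m' τ k m″ υ} → Steps p m σ j m' τ → Steps p m' τ k m″ υ → Steps p m σ (j + k) m″ υ
    steps-trans done     t = t
    steps-trans (step s) t = step (steps-trans s t)

    -- The flowchart of a part sits inside that of the whole with its exits wired to `e`, so a
    -- complete run of the part becomes a run of the whole that arrives at `e`. Every way of nesting
    -- programs is an instance.
    steps-embed : ∀ {p P} (f : Node p → Node P) (e : Maybe (Node P)) →
      (∀ a → opAt P (f a) ≡ opAt p a) → (∀ a b → goto P (f a) b ≡ redirect f e (goto p a b)) →
      ∀ {m σ k τ} → Steps p m σ k nothing τ → Steps P (redirect f e m) σ k e τ
    steps-embed f e h g done = done
    steps-embed {p} {P} f e h g {σ = σ} {τ = τ} (step {a} {k = k} s) =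
      step (subst (λ o → Steps P (goto P (f a) (proj₁ (eval o σ))) (proj₂ (eval o σ)) k e τ) (sym (h a))
           (subst (λ m → Steps P m (proj₂ (eval (opAt p a) σ)) k e τ) (sym (g a _)) (steps-embed f e h g s)))

    -- A compiled loop tests only after its body, so it makes at least one pass; this agrees with
    -- `iter L` because `0 < L`. Well-formedness keeps the body away from the counter, so the
    -- increment reports `L` in pass number `L` and in none before.
    compile-correct : 0 < L → ∀ p → WellFormed p → ∀ σ →
      Σ ℕ λ k → k ≤ cost p L × Steps p (just (entry p)) σ k nothing (sem p σ)
    compile-correct 0<L (op o) w σ = 1 , ≤-refl , step done
    compile-correct 0<L (ite o p q) (w , w') σ with proj₁ (eval o σ) in e
    ... | true  = let (k , b , s) = compile-correct 0<L p w (proj₂ (eval o σ)) in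
      suc k , s≤s (≤-trans b (m≤m+n _ _)) ,
      step (subst (λ c → Steps (ite o p q) (goto (ite o p q) nothing c) (proj₂ (eval o σ)) k nothing (sem p (proj₂ (eval o σ)))) (sym e)
             (steps-embed (just ∘ inj₁) nothing (λ _ → refl) (λ _ _ → refl) s))
    ... | false = let (k , b , s) = compile-correct 0<L q w' (proj₂ (eval o σ)) in
      suc k , s≤s (≤-trans b (m≤n+m _ _)) ,
      step (subst (λ c → Steps (ite o p q) (goto (ite o p q) nothing c) (proj₂ (eval o σ)) k nothing (sem q (proj₂ (eval o σ)))) (sym e)
             (steps-embed (just ∘ inj₂) nothing (λ _ → refl) (λ _ _ → refl) s))
    compile-correct 0<L (p ⨾ q) (w , w') σ =
      let (j , b , s)  = compile-correct 0<L p w σ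
          (k , b' , t) = compile-correct 0<L q w' (sem p σ)
      in j + k , +-mono-≤ b b' ,
         steps-trans (steps-embed inj₁ (just (inj₂ (entry q))) (λ _ → refl) (λ _ _ → refl) s)
                     (steps-embed inj₂ nothing (λ _ → refl) (λ _ _ → refl) t)
    compile-correct 0<L (loop i p) (av , w) σ = start L refl 0<L
      where
      P = loop i p
      body : Vec ℕ R → Vec ℕ R
      body τ = proj₂ (eval (inc i) (sem p τ))
      -- With the counter at `m`, there are `suc r` passes left, including the one about to start.
      turns : ∀ r m τ → m + suc r ≡ L → lookup τ i ≡ m →
        Σ ℕ λ k → k ≤ suc r * (cost p L + 1) × Steps P (just (just (just (entry p)))) τ k nothing (iter (suc r) body τ)
      turns r m τ e c with compile-correct 0<L p w τ
      ... | (k , b , s) = more r e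
        where
        τ' = sem p τ
        s' : Steps P (just (just (just (entry p)))) τ k (just (just nothing)) τ'
        s' = steps-embed (just ∘ just) (just (just nothing)) (λ _ → refl) (λ _ _ → refl) s
        c' : lookup τ' i ≡ m
        c' = trans (sem-avoids bs i p av τ) c
        flag : Bool → Set
        flag x = ((suc (lookup τ' i) ⊓ L) ≡ᵇ L) ≡ x
        go : ∀ {x j υ} → flag x → Steps P (goto P (just nothing) x) (body τ) j nothing υ → Steps P (just (just nothing)) τ' (suc j) nothing υ
        go refl t = step t
        val : m < L → suc (lookup τ' i) ⊓ L ≡ suc m
        val m<L = trans (cong (λ z → suc z ⊓ L) c') (m≤n⇒m⊓n≡m m<L)
        more : ∀ r → m + suc r ≡ L →
          Σ ℕ λ k → k ≤ suc r * (cost p L + 1) × Steps P (just (just (just (entry p)))) τ k nothing (iter (suc r) body τ)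
        more zero e = k + 1 , ≤-trans (+-monoˡ-≤ 1 b) (m≤m+n _ 0) , steps-trans s' (go fl done)
          where
          sm≡L : suc m ≡ L
          sm≡L = trans (+-comm 1 m) e
          fl : flag true
          fl = trans (cong (_≡ᵇ L) (trans (val (≤-reflexive sm≡L)) sm≡L)) (≡ᵇ-refl L)
        more (suc r) e =
          let (j , b' , t) = turns r (suc m) (body τ) e'
                               (trans (lookup∘update i (sem p τ) _) (val (≤-trans (s≤s (m≤m+n m (suc r))) (≤-reflexive e'))))
          in k + suc j , ≤-trans (≤-reflexive (solve 2 (λ k j → k :+ (con 1 :+ j) := (k :+ con 1) :+ j) refl k j))
                                 (+-mono-≤ (+-monoˡ-≤ 1 b) b') ,
             steps-trans s' (go fl t)
          where
          e' : suc m + suc r ≡ L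
          e' = trans (sym (+-suc m (suc r))) e
          sm<L : suc m < L
          sm<L = ≤-trans (≤-reflexive (+-comm 1 (suc m))) (≤-trans (+-monoʳ-≤ (suc m) (s≤s z≤n)) (≤-reflexive e'))
          fl : flag false
          fl = trans (cong (_≡ᵇ L) (val (<⇒≤ sm<L))) (≢⇒≡ᵇ-false (suc m) L (<⇒≢ sm<L))
      start : ∀ l → l ≡ L → 0 < l →
        Σ ℕ λ k → k ≤ cost P L × Steps P (just nothing) σ k nothing (sem P σ)
      start (suc r) e _ =
        let (k , b , s) = turns r 0 (σ [ i ]≔ 0) e (lookup∘update i σ 0)
        in suc k , s≤s (≤-trans b (≤-reflexive (cong (_* (cost p L + 1)) e))) ,
           step (subst (λ z → Steps P (just (just (just (entry p)))) (σ [ i ]≔ 0) k nothing (iter z body (σ [ i ]≔ 0))) e s)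

-- Registers as pebbles: the tape has cells 0, …, L, the last one being an end cell,
-- and register i has value v when cell v carries mark i.

Cell : ℕ → Set
Cell R = Maybe Bool × Vec Bool R

module _ {R : ℕ} where

  -- In `inc` the carry is the mark lifted from the previous cell. On the end cell a mark already
  -- present stays, which is the saturation at `L`, and the final carry says whether that cell is
  -- marked. In `clr` the carry is true on the first cell only. In `eq` and `bit` it is the answer
  -- found so far.
  opSweep : Op R → Sweep (Cell R)
  opSweep (inc i)  = sweep false λ where
    c (just b  , ms) → lookup ms i , (just b , ms [ i ]≔ c)
    c (nothing , ms) → (c ∨ lookup ms i) , (nothing , ms [ i ]≔ (c ∨ lookup ms i))
  opSweep (clr i)  = sweep true (λ (c : Bool) (x : Cell R) → false , (proj₁ x , proj₂ x [ i ]≔ c))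
  opSweep (eq i j) = sweep false (λ (c : Bool) (x : Cell R) → (c ∨ (lookup (proj₂ x) i ∧ lookup (proj₂ x) j)) , x)
  opSweep (bit i)  = sweep false (λ (c : Bool) (x : Cell R) → (c ∨ (lookup (proj₂ x) i ∧ fromMaybe false (proj₁ x))) , x)

  marks : ℕ → Vec ℕ R → Vec Bool R
  marks j = map (_≡ᵇ j)

  cells : ℕ → List Bool → Vec ℕ R → List (Cell R)
  cells j [] σ       = (nothing , marks j σ) ∷ []
  cells j (b ∷ bs) σ = (just b , marks j σ) ∷ cells (suc j) bs σ

  length-cells : ∀ j bs σ → length (cells j bs σ) ≡ suc (length bs)
  length-cells j [] σ       = refl
  length-cells j (b ∷ bs) σ = cong suc (length-cells (suc j) bs σ)

  marks-update : ∀ j σ i v {c} → (v ≡ᵇ j) ≡ c → marks j σ [ i ]≔ c ≡ marks j (σ [ i ]≔ v)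
  marks-update j σ i v refl = sym (map-[]≔ (_≡ᵇ j) σ i)

  sweepOp : Op R → Bool → List (Cell R) → Bool × List (Cell R)
  sweepOp o = sweepList (Sweep.turn (opSweep o))

  inc-at-end : ∀ v j → v ≤ j → ((suc v ≡ᵇ j) ∨ (v ≡ᵇ j)) ≡ ((suc v ⊓ j) ≡ᵇ j)
  inc-at-end zero zero p             = refl
  inc-at-end zero (suc zero) p       = refl
  inc-at-end zero (suc (suc j)) p    = refl
  inc-at-end (suc v) (suc j) (s≤s p) = inc-at-end v j p

  -- The carry arriving at cell `j` says that the old mark lay on the cell just before. For `j = 0`
  -- this computes to `false`, the initial carry of `inc`.
  sweep-inc : ∀ i bs j N σ → j + length bs ≡ N → lookup σ i ≤ N →
    sweepOp (inc i) (suc (lookup σ i) ≡ᵇ j) (cells j bs σ)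
      ≡ (((suc (lookup σ i) ⊓ N) ≡ᵇ N) , cells j bs (σ [ i ]≔ (suc (lookup σ i) ⊓ N)))
  sweep-inc i [] j N σ e v≤N with trans (sym (+-identityʳ j)) e
  ... | refl rewrite lookup-map i (_≡ᵇ j) σ | inc-at-end (lookup σ i) j v≤N =
    cong (λ z → (suc (lookup σ i) ⊓ j ≡ᵇ j) , (nothing , z) ∷ []) (marks-update j σ i (suc (lookup σ i) ⊓ j) refl)
  sweep-inc i (b ∷ bs) j N σ e v≤N rewrite lookup-map i (_≡ᵇ j) σ =
    cong₂ (λ z r → proj₁ r , (just b , z) ∷ proj₂ r)
      (marks-update j σ i (suc (lookup σ i) ⊓ N) (inner (suc (lookup σ i))))
      (sweep-inc i bs (suc j) N σ (trans (sym (+-suc j (length bs))) e) v≤N)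
    where
    j<N : j < N
    j<N = ≤-trans (s≤s (m≤m+n j (length bs))) (≤-reflexive (trans (sym (+-suc j (length bs))) e))
    -- The cap cannot be seen from a cell before the last one.
    inner : ∀ w → ((w ⊓ N) ≡ᵇ j) ≡ (w ≡ᵇ j)
    inner w with ≤-total w N
    ... | inj₁ w≤N rewrite m≤n⇒m⊓n≡m w≤N = refl
    ... | inj₂ N≤w rewrite m≥n⇒m⊓n≡n N≤w =
      trans (≢⇒≡ᵇ-false N j (<⇒≢ j<N ∘ sym)) (sym (≢⇒≡ᵇ-false w j (<⇒≢ (<-≤-trans j<N N≤w) ∘ sym)))

  sweep-clr′ : ∀ i bs j σ → sweepOp (clr i) false (cells (suc j) bs σ) ≡ (false , cells (suc j) bs (σ [ i ]≔ 0))
  sweep-clr′ i [] j σ       = cong (λ z → false , (nothing , z) ∷ []) (marks-update (suc j) σ i 0 refl)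
  sweep-clr′ i (b ∷ bs) j σ = cong₂ (λ z r → proj₁ r , (just b , z) ∷ proj₂ r)
    (marks-update (suc j) σ i 0 refl) (sweep-clr′ i bs (suc j) σ)

  sweep-clr : ∀ i bs σ → sweepOp (clr i) true (cells 0 bs σ) ≡ (false , cells 0 bs (σ [ i ]≔ 0))
  sweep-clr i [] σ       = cong (λ z → false , (nothing , z) ∷ []) (marks-update 0 σ i 0 refl)
  sweep-clr i (b ∷ bs) σ = cong₂ (λ z r → proj₁ r , (just b , z) ∷ proj₂ r)
    (marks-update 0 σ i 0 refl) (sweep-clr′ i bs 0 σ)

  -- Both `eq` and `bit` ask for a property `h` of the one cell that carries mark `i`: the presence
  -- of another mark, or the input bit stored there.
  module Probe (i : Fin R) (h : Cell R → Bool) where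

    probe : Bool → Cell R → Bool × Cell R
    probe c x = (c ∨ (lookup (proj₂ x) i ∧ h x)) , x

    probe-miss : ∀ bs j σ c → lookup σ i < j → sweepList probe c (cells j bs σ) ≡ (c , cells j bs σ)
    probe-miss [] j σ c v<j
      rewrite lookup-map i (_≡ᵇ j) σ | ≢⇒≡ᵇ-false (lookup σ i) j (<⇒≢ v<j) | ∨-identityʳ c = refl
    probe-miss (b ∷ bs) j σ c v<j
      rewrite lookup-map i (_≡ᵇ j) σ | ≢⇒≡ᵇ-false (lookup σ i) j (<⇒≢ v<j) | ∨-identityʳ c
            | probe-miss bs (suc j) σ c (m<n⇒m<1+n v<j) = refl

    probe-hit : ∀ bs j d σ → lookup σ i ≡ j + d → d ≤ length bs →
      sweepList probe false (cells j bs σ) ≡ (h (at bs d , marks (lookup σ i) σ) , cells j bs σ)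
    probe-hit [] j zero σ e z≤n
      rewrite lookup-map i (_≡ᵇ j) σ | e | +-identityʳ j | ≡ᵇ-refl j = refl
    probe-hit (b ∷ bs) j zero σ e z≤n
      rewrite lookup-map i (_≡ᵇ j) σ | trans e (+-identityʳ j) | ≡ᵇ-refl j
            | probe-miss bs (suc j) σ (h (just b , marks j σ)) (≤-reflexive (cong suc (trans e (+-identityʳ j)))) = refl
    probe-hit (b ∷ bs) j (suc d) σ e (s≤s d≤)
      rewrite lookup-map i (_≡ᵇ j) σ
            | ≢⇒≡ᵇ-false (lookup σ i) j (λ v≡j → m≢1+m+n j (trans (sym v≡j) (trans e (+-suc j d))))
            | probe-hit bs (suc j) d σ (trans e (+-suc j d)) d≤ = refl

  Bounded : List Bool → Vec ℕ R → Set
  Bounded bs σ = ∀ i → lookup σ i ≤ length bs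

  module _ (bs : List Bool) where
    open Semantics {R} bs

    bounded-update : ∀ σ i v → Bounded bs σ → v ≤ L → Bounded bs (σ [ i ]≔ v)
    bounded-update σ i v B v≤L k with k Fin.≟ i
    ... | yes refl = ≤-trans (≤-reflexive (lookup∘update k σ v)) v≤L
    ... | no k≢i   = ≤-trans (≤-reflexive (lookup∘update′ k≢i σ v)) (B k)

    eval-bounded : ∀ o σ → Bounded bs σ → Bounded bs (proj₂ (eval o σ))
    eval-bounded (inc i)  σ B = bounded-update σ i _ B (m⊓n≤n (suc (lookup σ i)) L)
    eval-bounded (clr i)  σ B = bounded-update σ i 0 B z≤n
    eval-bounded (eq _ _) σ B = B
    eval-bounded (bit _)  σ B = B

    sweep-eval : ∀ o σ → Bounded bs σ →
      sweepOp o (Sweep.init (opSweep o)) (cells 0 bs σ) ≡ (proj₁ (eval o σ) , cells 0 bs (proj₂ (eval o σ)))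
    sweep-eval (inc i) σ B = sweep-inc i bs 0 L σ refl (B i)
    sweep-eval (clr i) σ B = sweep-clr i bs σ
    sweep-eval (eq i j) σ B =
      trans (Probe.probe-hit i (λ x → lookup (proj₂ x) j) bs 0 (lookup σ i) σ refl (B i))
            (cong (_, cells 0 bs σ) (trans (lookup-map j (_≡ᵇ lookup σ i) σ) (≡ᵇ-comm (lookup σ j) (lookup σ i))))
      where
      ≡ᵇ-comm : ∀ m n → (m ≡ᵇ n) ≡ (n ≡ᵇ m)
      ≡ᵇ-comm zero    zero    = refl
      ≡ᵇ-comm zero    (suc n) = refl
      ≡ᵇ-comm (suc m) zero    = refl
      ≡ᵇ-comm (suc m) (suc n) = ≡ᵇ-comm m n
    sweep-eval (bit i) σ B = Probe.probe-hit i (λ x → fromMaybe false (proj₁ x)) bs 0 (lookup σ i) σ refl (B i)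

  -- The additional node `nothing` is where `p` exits to: it compares `a` with `z` and halts,
  -- accepting when they differ.
  module Compiled (p : Prog R) (a z : Fin R) where

    flow : Flow (Cell R)
    flow = record
      { Node  = Maybe (Node p)
      ; fin   = finite-Maybe (finite-Node p)
      ; entry = just (entry p)
      ; act   = λ n → opSweep (maybe (opAt p) (eq a z) n)
      ; next  = λ { nothing b → inj₂ (not b) ; (just n) b → inj₁ (goto p n b) }
      }

    open Sweeping (finite-× (finite-Maybe finite-Bool) (finite-Vec finite-Bool R)) flow
      -- All registers start at 0, hence all marks on the first cell.
      (λ b → just b , replicate R true) (λ b → just b , replicate R false) (nothing , replicate R false)
      hiding (step) public

    -- The working area has `suc L` cells because of the end cell; the last summand pays for the
    -- final comparison.
    time : ℕ → ℕ
    time L = bootTime L + (cost p L * roundtrip (suc L) + roundtrip (suc L))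

    poly-time : Poly time
    poly-time = poly-+ (poly-+ (poly-+ poly-id poly-id) (poly-const 6)) (poly-+ (poly-* (poly-cost p) trip) trip)
      where
      sL : Poly suc
      sL = poly-+ (poly-const 1) poly-id
      trip : Poly (λ L → roundtrip (suc L))
      trip = poly-+ sL (poly-+ (poly-const 1) (poly-+ sL (poly-const 1)))

    σ₀ : Vec ℕ R
    σ₀ = replicate R 0

    module _ (bs : List Bool) where
      open Semantics {R} bs

      round-eval : ∀ n σ → Bounded bs σ → ∀ f →
        exec (roundtrip (suc L) + f) (home n (cells 0 bs σ)) ≡
          (let o = maybe (opAt p) (eq a z) n in
           execStep f (enter (Flow.next flow n (proj₁ (eval o σ)))) []
             (List.map cell (cells 0 bs (proj₂ (eval o σ))) ++ blk ∷ []))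
      round-eval n σ B f =
        trans (cong (λ m → exec (roundtrip m + f) (home n (cells 0 bs σ))) (sym (length-cells 0 bs σ)))
        (trans (round n (cells 0 bs σ) f)
               (cong (λ r → execStep f (enter (Flow.next flow n (proj₁ r))) [] (List.map cell (proj₂ r) ++ blk ∷ []))
                     (sweep-eval bs (maybe (opAt p) (eq a z) n) σ B)))

      steps-exec : ∀ {m σ k τ} → Steps bs p m σ k nothing τ → Bounded bs σ → ∀ f →
        Bounded bs τ × exec (k * roundtrip (suc L) + f) (home m (cells 0 bs σ)) ≡ exec f (home nothing (cells 0 bs τ))
      steps-exec done B f = B , refl
      steps-exec (step {n} {σ} {k} s) B f =
        let (B' , e) = steps-exec s (eval-bounded bs (opAt p n) σ B) f
        in B' , trans (cong (λ t → exec t (home (just n) (cells 0 bs σ))) (+-assoc (roundtrip (suc L)) (k * roundtrip (suc L)) f))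
                (trans (round-eval (just n) σ B (k * roundtrip (suc L) + f)) e)

    initial-cells : ∀ b bs → (just b , replicate R true) ∷ List.map (λ b → just b , replicate R false) bs ++ (nothing , replicate R false) ∷ []
                    ≡ cells 0 (b ∷ bs) σ₀
    initial-cells b bs = cong₂ (λ x y → (just b , x) ∷ y) (sym (map-replicate (_≡ᵇ 0) 0 R)) (tail bs 0)
      where
      tail : ∀ bs j → List.map (λ b → just b , replicate R false) bs ++ (nothing , replicate R false) ∷ [] ≡ cells (suc j) bs σ₀
      tail [] j       = cong (λ x → (nothing , x) ∷ []) (sym (map-replicate (_≡ᵇ suc j) 0 R))
      tail (b ∷ bs) j = cong₂ (λ x y → (just b , x) ∷ y) (sym (map-replicate (_≡ᵇ suc j) 0 R)) (tail bs (suc j))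

    run-compiled : WellFormed p → ∀ b bs →
      (let σ = Semantics.sem (b ∷ bs) p σ₀ ; (c , d , _) = poly-time in
       run machine (c * suc (length (b ∷ bs)) ^ d) (initial machine (b ∷ bs)) ≡ just (not (lookup σ a ≡ᵇ lookup σ z)))
    run-compiled w b bs with compile-correct (b ∷ bs) (s≤s z≤n) p w σ₀
    ... | (k , k≤ , s) = trans (run-raw fuel b bs) (trans (cong (λ t → exec t start) (sym (m+[n∸m]≡n used≤fuel))) (exec-mono {used} _ halts))
      where
      L fuel used : ℕ
      L    = suc (length bs)
      fuel = proj₁ poly-time * suc L ^ proj₁ (proj₂ poly-time)
      used = bootTime (length bs) + (k * roundtrip (suc L) + (roundtrip (suc L) + 0))
      start : Conf
      start = conf nothing [] (raw b) (List.map raw bs)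
      used≤fuel : used ≤ fuel
      used≤fuel = ≤-trans
        (+-mono-≤ (+-monoˡ-≤ 6 (+-mono-≤ (n≤1+n (length bs)) (n≤1+n (length bs))))
                  (+-mono-≤ (*-monoˡ-≤ (roundtrip (suc L)) k≤) (≤-reflexive (+-identityʳ _))))
        (proj₂ (proj₂ poly-time) L)
      σ₀-bounded : Bounded (b ∷ bs) σ₀
      σ₀-bounded i = ≤-trans (≤-reflexive (lookup-replicate i 0)) z≤n
      halts : exec used start ≡ just (not (lookup (Semantics.sem (b ∷ bs) p σ₀) a ≡ᵇ lookup (Semantics.sem (b ∷ bs) p σ₀) z))
      halts = let (B , e) = steps-exec (b ∷ bs) s σ₀-bounded (roundtrip (suc L) + 0) in
        trans (boot b bs _)
        (trans (cong (λ xs → exec (k * roundtrip (suc L) + (roundtrip (suc L) + 0)) (home (just (entry p)) xs)) (initial-cells b bs))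
        (trans e (round-eval (b ∷ bs) nothing (Semantics.sem (b ∷ bs) p σ₀) B 0)))

verdict : ∀ {R} → Fin R → Fin R → Vec ℕ R → Bool
verdict a z σ = not (lookup σ a ≡ᵇ lookup σ z)

PolyTime : (List Bool → Bool) → Set
PolyTime f = Σ TM λ M → Σ ℕ λ c → Σ ℕ λ d → ∀ xs → 0 < length xs →
  run M (c * suc (length xs) ^ d) (initial M xs) ≡ just (f xs)

program-polyTime : ∀ {R} (p : Prog R) → WellFormed p → ∀ a z →
  PolyTime (λ xs → verdict a z (Semantics.sem xs p (replicate R 0)))
program-polyTime p w a z = machine , proj₁ poly-time , proj₁ (proj₂ poly-time) , λ { (b ∷ bs) _ → run-compiled w b bs }
  where open Compiled p a z

-- Doubling and minimum as register programs

divMod-unique : ∀ k u v i j → v < k → j < k → u * k + v ≡ i * k + j → u ≡ i × v ≡ j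
divMod-unique k zero    v zero    j v<k j<k e = refl , e
divMod-unique k zero    v (suc i) j v<k j<k e =
  ⊥-elim (<⇒≱ v<k (≤-trans (m≤m+n k (i * k + j)) (≤-reflexive (trans (sym (+-assoc k (i * k) j)) (sym e)))))
divMod-unique k (suc u) v zero    j v<k j<k e =
  ⊥-elim (<⇒≱ j<k (≤-trans (m≤m+n k (u * k + v)) (≤-reflexive (trans (sym (+-assoc k (u * k) v)) e))))
divMod-unique k (suc u) v (suc i) j v<k j<k e =
  let (u≡i , v≡j) = divMod-unique k u v i j v<k j<k
        (+-cancelˡ-≡ k _ _ (trans (sym (+-assoc k (u * k) v)) (trans e (+-assoc k (i * k) j))))
  in cong suc u≡i , v≡j

square-injective : ∀ m n → m * m ≡ n * n → m ≡ n
square-injective m n e with <-cmp m n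
... | tri< m<n _ _ = ⊥-elim (<⇒≢ (*-mono-< m<n m<n) e)
... | tri≈ _ m≡n _ = m≡n
... | tri> _ _ n<m = ⊥-elim (<⇒≢ (*-mono-< n<m n<m) (sym e))

-- A value that has hit the cap stays there when doubled, so capped powers of two can be updated
-- from their capped predecessors.
double-⊓ : ∀ a L → (a ⊓ L + a ⊓ L) ⊓ L ≡ (2 * a) ⊓ L
double-⊓ a L with ≤-total a L
... | inj₁ a≤L rewrite m≤n⇒m⊓n≡m a≤L = cong (λ z → (a + z) ⊓ L) (sym (+-identityʳ a))
... | inj₂ L≤a rewrite m≥n⇒m⊓n≡n L≤a =
  trans (m≥n⇒m⊓n≡n (m≤m+n L L)) (sym (m≥n⇒m⊓n≡n (≤-trans L≤a (m≤m+n a (a + 0)))))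

suc-⊓ : ∀ a L → suc (a ⊓ L) ⊓ L ≡ suc a ⊓ L
suc-⊓ a L with ≤-total a L
... | inj₁ a≤L rewrite m≤n⇒m⊓n≡m a≤L = refl
... | inj₂ L≤a rewrite m≥n⇒m⊓n≡n L≤a =
  trans (m≥n⇒m⊓n≡n (n≤1+n L)) (sym (m≥n⇒m⊓n≡n (≤-trans L≤a (n≤1+n a))))

count : (ℕ → Bool) → ℕ → ℕ
count f zero    = 0
count f (suc p) = if f p then suc (count f p) else count f p

count≤ : ∀ f p → count f p ≤ p
count≤ f zero    = z≤n
count≤ f (suc p) with f p
... | true  = s≤s (count≤ f p)
... | false = m≤n⇒m≤1+n (count≤ f p)

skip : ∀ {R} → Fin R → Prog R
skip i = op (eq i i)

-- With neither addition nor copying available, `w` enters as a second copy of `x`. While `c` climbs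
-- from 0 to `x`, `w` climbs along with it; then `x` is raised to meet `w`, and the two copies agree
-- again for the next doubling.
double : ∀ {R} (x w c m : Fin R) → Prog R
double x w c m =
  op (clr c) ⨾ loop m (ite (eq c x) (skip c) (op (inc c) ⨾ op (inc w))) ⨾
  loop m (ite (eq x w) (skip c) (op (inc x))) ⨾ op (clr c) ⨾ op (clr m)

-- An order test made from equality tests: `c` climbs until it meets `w` or `x`, so afterwards
-- `c = w` exactly when `w` is at most `x`.
minimum : ∀ {R} (x w c m : Fin R) → Prog R
minimum x w c m = op (clr c) ⨾ loop m (ite (eq c w) (skip c) (ite (eq c x) (skip c) (op (inc c))))

module Rules {R : ℕ} (bs : List Bool) where
  open Semantics {R} bs public

  loop-rule : ∀ i p σ (I : ℕ → Vec ℕ R → Set) → I 0 (σ [ i ]≔ 0) →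
    (∀ q τ → q < L → I q τ → I (suc q) (proj₂ (eval (inc i) (sem p τ)))) → I L (sem (loop i p) σ)
  loop-rule i p σ I base ind = go L 0 _ refl base
    where
    go : ∀ r q τ → q + r ≡ L → I q τ → I L (iter r (λ τ → proj₂ (eval (inc i) (sem p τ))) τ)
    go zero    q τ e h = subst (λ z → I z τ) (trans (sym (+-identityʳ q)) e) h
    go (suc r) q τ e h =
      go r (suc q) _ (trans (sym (+-suc q r)) e)
         (ind q τ (≤-trans (s≤s (m≤m+n q r)) (≤-reflexive (trans (sym (+-suc q r)) e))) h)

  ite-eq : ∀ i j p q σ → lookup σ i ≡ lookup σ j → sem (ite (eq i j) p q) σ ≡ sem p σ
  ite-eq i j p q σ e rewrite e | ≡ᵇ-refl (lookup σ j) = refl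

  ite-≢ : ∀ i j p q σ → lookup σ i ≢ lookup σ j → sem (ite (eq i j) p q) σ ≡ sem q σ
  ite-≢ i j p q σ e rewrite ≢⇒≡ᵇ-false _ _ e = refl

  -- Four registers inside a fixed frame, abstracted so that one proof serves both (X, X') and (Y, Y').
  record View (x w c m : Fin R) (fr : ℕ → ℕ → ℕ → ℕ → Vec ℕ R) : Set where
    field
      getX : ∀ {a b d e} → lookup (fr a b d e) x ≡ a
      getW : ∀ {a b d e} → lookup (fr a b d e) w ≡ b
      getC : ∀ {a b d e} → lookup (fr a b d e) c ≡ d
      getM : ∀ {a b d e} → lookup (fr a b d e) m ≡ e
      setX : ∀ {a b d e} v → fr a b d e [ x ]≔ v ≡ fr v b d e
      setW : ∀ {a b d e} v → fr a b d e [ w ]≔ v ≡ fr a v d e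
      setC : ∀ {a b d e} v → fr a b d e [ c ]≔ v ≡ fr a b v e
      setM : ∀ {a b d e} v → fr a b d e [ m ]≔ v ≡ fr a b d v

  module _ {x w c m : Fin R} {fr : ℕ → ℕ → ℕ → ℕ → Vec ℕ R} (V : View x w c m fr) where
    open View V

    incX : ∀ a b d e → sem (op (inc x)) (fr a b d e) ≡ fr (suc a ⊓ L) b d e
    incX a b d e rewrite getX {a} {b} {d} {e} = setX _

    incW : ∀ a b d e → sem (op (inc w)) (fr a b d e) ≡ fr a (suc b ⊓ L) d e
    incW a b d e rewrite getW {a} {b} {d} {e} = setW _

    incC : ∀ a b d e → sem (op (inc c)) (fr a b d e) ≡ fr a b (suc d ⊓ L) e
    incC a b d e rewrite getC {a} {b} {d} {e} = setC _

    if-C-X-≡ : ∀ p q a b d e → d ≡ a → sem (ite (eq c x) p q) (fr a b d e) ≡ sem p (fr a b d e)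
    if-C-X-≡ p q a b d e h = ite-eq c x p q (fr a b d e) (trans getC (trans h (sym getX)))

    if-C-X-≢ : ∀ p q a b d e → d ≢ a → sem (ite (eq c x) p q) (fr a b d e) ≡ sem q (fr a b d e)
    if-C-X-≢ p q a b d e h = ite-≢ c x p q (fr a b d e) (λ k → h (trans (sym getC) (trans k getX)))

    if-X-W-≡ : ∀ p q a b d e → a ≡ b → sem (ite (eq x w) p q) (fr a b d e) ≡ sem p (fr a b d e)
    if-X-W-≡ p q a b d e h = ite-eq x w p q (fr a b d e) (trans getX (trans h (sym getW)))

    if-X-W-≢ : ∀ p q a b d e → a ≢ b → sem (ite (eq x w) p q) (fr a b d e) ≡ sem q (fr a b d e)
    if-X-W-≢ p q a b d e h = ite-≢ x w p q (fr a b d e) (λ k → h (trans (sym getX) (trans k getW)))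

    if-C-W-≡ : ∀ p q a b d e → d ≡ b → sem (ite (eq c w) p q) (fr a b d e) ≡ sem p (fr a b d e)
    if-C-W-≡ p q a b d e h = ite-eq c w p q (fr a b d e) (trans getC (trans h (sym getW)))

    if-C-W-≢ : ∀ p q a b d e → d ≢ b → sem (ite (eq c w) p q) (fr a b d e) ≡ sem q (fr a b d e)
    if-C-W-≢ p q a b d e h = ite-≢ c w p q (fr a b d e) (λ k → h (trans (sym getC) (trans k getW)))

    tick : ∀ {σ a b d q} → σ ≡ fr a b d q → q < L → proj₂ (eval (inc m) σ) ≡ fr a b d (suc q)
    tick {a = a} {b} {d} {q} refl q<L rewrite getM {a} {b} {d} {q} | m≤n⇒m⊓n≡m q<L = setM _

    double-correct : ∀ a d e → a ≤ L →
      sem (double x w c m) (fr a a d e) ≡ fr ((a + a) ⊓ L) ((a + a) ⊓ L) 0 0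
    double-correct a d e a≤L = begin
      sem (double x w c m) (fr a a d e)                       ≡⟨ cong (sem (loop m p ⨾ rest)) (setC 0) ⟩
      sem (loop m p ⨾ rest) (fr a a 0 e)                      ≡⟨ cong (sem rest) first ⟩
      sem rest (fr a b a L)                                   ≡⟨ cong (sem (op (clr c) ⨾ op (clr m))) second ⟩
      sem (op (clr c) ⨾ op (clr m)) (fr b b a L)              ≡⟨ cong (sem (op (clr m))) (setC 0) ⟩
      sem (op (clr m)) (fr b b 0 L)                           ≡⟨ setM 0 ⟩
      fr b b 0 0 ∎
      where
      open ≡-Reasoning
      b = (a + a) ⊓ L
      p q rest : Prog R
      p = ite (eq c x) (skip c) (op (inc c) ⨾ op (inc w))
      q = ite (eq x w) (skip c) (op (inc x))
      rest = loop m q ⨾ op (clr c) ⨾ op (clr m)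
      a≤b : a ≤ b
      a≤b = ⊓-glb (m≤m+n a a) a≤L
      I : ℕ → Vec ℕ R → Set
      I r τ = τ ≡ fr a ((a + r ⊓ a) ⊓ L) (r ⊓ a) r
      first : sem (loop m p) (fr a a 0 e) ≡ fr a b a L
      first = trans (loop-rule m p (fr a a 0 e) I
          (trans (setM 0) (cong (λ z → fr a z 0 0) (sym (trans (cong (_⊓ L) (+-identityʳ a)) (m≤n⇒m⊓n≡m a≤L)))))
          (λ { r .(fr a ((a + r ⊓ a) ⊓ L) (r ⊓ a) r) r<L refl → tick (body r r<L) r<L }))
        (cong (λ z → fr a ((a + z) ⊓ L) z L) (m≥n⇒m⊓n≡n a≤L))
        where
        body : ∀ r → r < L → sem p (fr a ((a + r ⊓ a) ⊓ L) (r ⊓ a) r) ≡ fr a ((a + suc r ⊓ a) ⊓ L) (suc r ⊓ a) r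
        body r r<L with r <? a
        ... | yes r<a rewrite m≤n⇒m⊓n≡m (<⇒≤ r<a) | m≤n⇒m⊓n≡m r<a = begin
          sem p (fr a ((a + r) ⊓ L) r r)
            ≡⟨ if-C-X-≢ (skip c) (op (inc c) ⨾ op (inc w)) a ((a + r) ⊓ L) r r (<⇒≢ r<a) ⟩
          sem (op (inc c) ⨾ op (inc w)) (fr a ((a + r) ⊓ L) r r)
            ≡⟨ cong (sem (op (inc w))) (trans (incC a ((a + r) ⊓ L) r r) (cong (λ z → fr a ((a + r) ⊓ L) z r) (m≤n⇒m⊓n≡m r<L))) ⟩
          sem (op (inc w)) (fr a ((a + r) ⊓ L) (suc r) r)
            ≡⟨ incW a ((a + r) ⊓ L) (suc r) r ⟩
          fr a (suc ((a + r) ⊓ L) ⊓ L) (suc r) r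
            ≡⟨ cong (λ z → fr a z (suc r) r) (trans (suc-⊓ (a + r) L) (cong (_⊓ L) (sym (+-suc a r)))) ⟩
          fr a ((a + suc r) ⊓ L) (suc r) r ∎
        ... | no r≮a rewrite m≥n⇒m⊓n≡n (≮⇒≥ r≮a) | m≥n⇒m⊓n≡n (≤-trans (≮⇒≥ r≮a) (n≤1+n r)) =
          if-C-X-≡ (skip c) (op (inc c) ⨾ op (inc w)) a ((a + a) ⊓ L) a r refl
      J : ℕ → Vec ℕ R → Set
      -- The target `b` is at most `L`, so the `L` passes suffice for `x` to reach it.
      J r τ = τ ≡ fr ((a + r) ⊓ b) b a r
      second : sem (loop m q) (fr a b a L) ≡ fr b b a L
      second = trans (loop-rule m q (fr a b a L) J
          (trans (setM 0) (cong (λ z → fr z b a 0) (sym (trans (cong (_⊓ b) (+-identityʳ a)) (m≤n⇒m⊓n≡m a≤b)))))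
          (λ { r .(fr ((a + r) ⊓ b) b a r) r<L refl → tick (body r) r<L }))
        (cong (λ z → fr z b a L) (m≥n⇒m⊓n≡n (≤-trans (m⊓n≤n (a + a) L) (m≤n+m L a))))
        where
        body : ∀ r → sem q (fr ((a + r) ⊓ b) b a r) ≡ fr ((a + suc r) ⊓ b) b a r
        body r rewrite +-suc a r with a + r <? b
        ... | yes h rewrite m≤n⇒m⊓n≡m (<⇒≤ h) | m≤n⇒m⊓n≡m h =
          trans (if-X-W-≢ (skip c) (op (inc x)) (a + r) b a r (<⇒≢ h))
          (trans (incX (a + r) b a r) (cong (λ z → fr z b a r) (m≤n⇒m⊓n≡m (≤-trans h (m⊓n≤n (a + a) L)))))
        ... | no h rewrite m≥n⇒m⊓n≡n (≮⇒≥ h) | m≥n⇒m⊓n≡n (≤-trans (≮⇒≥ h) (n≤1+n (a + r))) =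
          if-X-W-≡ (skip c) (op (inc x)) b b a r refl

    minimum-correct : ∀ a b d e → b ≤ L → sem (minimum x w c m) (fr a b d e) ≡ fr a b (b ⊓ a) L
    minimum-correct a b d e b≤L =
      trans (cong (sem (loop m p)) (setC 0))
      (trans (loop-rule m p (fr a b 0 e) (λ r τ → τ ≡ fr a b (r ⊓ g) r)
         (setM 0)
         (λ { r .(fr a b (r ⊓ g) r) r<L refl → tick (body r r<L) r<L }))
       (cong (λ z → fr a b z L) (m≥n⇒m⊓n≡n (≤-trans (m⊓n≤m b a) b≤L))))
      where
      g = b ⊓ a
      p p' : Prog R
      p' = ite (eq c x) (skip c) (op (inc c))
      p = ite (eq c w) (skip c) (ite (eq c x) (skip c) (op (inc c)))
      body : ∀ r → r < L → sem p (fr a b (r ⊓ g) r) ≡ fr a b (suc r ⊓ g) r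
      body r r<L with r <? g
      ... | yes h rewrite m≤n⇒m⊓n≡m (<⇒≤ h) | m≤n⇒m⊓n≡m h =
        trans (if-C-W-≢ (skip c) p' a b r r (<⇒≢ (<-≤-trans h (m⊓n≤m b a))))
        (trans (if-C-X-≢ (skip c) (op (inc c)) a b r r (<⇒≢ (<-≤-trans h (m⊓n≤n b a))))
        (trans (incC a b r r) (cong (λ z → fr a b z r) (m≤n⇒m⊓n≡m r<L))))
      ... | no h rewrite m≥n⇒m⊓n≡n (≮⇒≥ h) | m≥n⇒m⊓n≡n (≤-trans (≮⇒≥ h) (n≤1+n r)) with ⊓-sel b a
      ...   | inj₁ g≡b = if-C-W-≡ (skip c) p' a b g r g≡b
      ...   | inj₂ g≡a with g ≟ b
      ...     | yes g≡b = if-C-W-≡ (skip c) p' a b g r g≡b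
      ...     | no g≢b  = trans (if-C-W-≢ (skip c) p' a b g r g≢b)
                                (if-C-X-≡ (skip c) (op (inc c)) a b g r g≡a)

-- The decision program

-- k is the candidate for the number of vertices and pos = i * k + j runs over the input;
-- s and t count the zeros and ones of row 0, X = X' = 2 ^ s and Y = Y' = 2 ^ t (capped at L),
-- c and m are scratch. In census, i is reused as a flag for pos having left row 0.
rk rpos ri rj rbad rzero rtwo rans rs rt rX rX' rY rY' rc rm : Fin 16
rk    = # 0
rpos  = # 1
ri    = # 2
rj    = # 3
rbad  = # 4
rzero = # 5
rtwo  = # 6
rans  = # 7
rs    = # 8
rt    = # 9
rX    = # 10
rX'   = # 11
rY    = # 12
rY'   = # 13
rc    = # 14
rm    = # 15

-- `check` computes the parity of the entry at `pos` and the entries `i` and `j` of row 0, and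
-- counts a clash in `rbad` when it is odd. `validate` accepts a candidate as the side length only
-- if the scan has stopped at `i = k`, `j = 0`; only then is `census` considered, so at most one
-- candidate can touch the answer.
check advance scan countBit tallyRow tally compareZeros compareOnes census checkSize checkBad validate attempt decider : Prog 16

check = ite (bit rpos) (ite (bit ri) (ite (bit rj) (op (inc rbad)) (skip rk)) (ite (bit rj) (skip rk) (op (inc rbad))))
                       (ite (bit ri) (ite (bit rj) (skip rk) (op (inc rbad))) (ite (bit rj) (op (inc rbad)) (skip rk)))
advance = op (inc rj) ⨾ ite (eq rj rk) (op (clr rj) ⨾ op (inc ri)) (skip rk)
scan = check ⨾ advance

countBit = ite (bit rpos) (op (inc rt) ⨾ double rY rY' rc rm) (op (inc rs) ⨾ double rX rX' rc rm)
tallyRow = ite (eq ri rzero) countBit (skip rk)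
tally = ite (eq rpos rk) (op (inc ri)) (skip rk) ⨾ tallyRow
compareZeros = ite (eq rc rs) (op (inc rans)) (skip rk)
compareOnes = ite (eq rc rt) (minimum rY rs rc rm ⨾ compareZeros) (skip rk)
census = op (inc rX) ⨾ op (inc rX') ⨾ op (inc rY) ⨾ op (inc rY') ⨾ op (clr ri) ⨾ loop rpos tally ⨾
         minimum rX rt rc rm ⨾ compareOnes

checkSize = ite (eq rk rtwo) (skip rk) census
checkBad = ite (eq rbad rzero) checkSize (skip rk)
validate = ite (eq ri rk) (ite (eq rj rzero) checkBad (skip rk)) (skip rk)
attempt = op (clr ri) ⨾ op (clr rj) ⨾ op (clr rbad) ⨾ loop rpos scan ⨾ validate
decider = op (inc rtwo) ⨾ op (inc rtwo) ⨾ loop rk attempt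

decider-wf : WellFormed decider
decider-wf = _

xor-false⇒≡ : ∀ x y → x xor y ≡ false → x ≡ y
xor-false⇒≡ false false _ = refl
xor-false⇒≡ true  true  _ = refl

-- Correctness of the decision program

module _ (bs : List Bool) where
  open Rules {16} bs

  private
    β : ℕ → Bool
    β = nth bs

  -- The bound `m` on positions makes this an invariant of the scan. For `k = n` and `m = L` it says
  -- that row 0 is the indicator of one part of a complete bipartite graph.
  RankOne : ℕ → ℕ → Set
  RankOne k m = ∀ u v → v < k → u * k + v < m → β (u * k + v) ≡ β u xor β v

  module Scan (k : ℕ) (rest : Vec ℕ 10) (L>0 : 0 < L) where

    st : ℕ → ℕ → ℕ → ℕ → Vec ℕ 16
    st p i j b = k ∷ p ∷ i ∷ j ∷ b ∷ 0 ∷ rest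

    clash : ℕ → ℕ → ℕ → Bool
    clash p i j = β p xor (β i xor β j)

    bump : Bool → ℕ → ℕ
    bump c b = if c then suc b ⊓ L else b

    check-correct : ∀ p i j b → sem check (st p i j b) ≡ st p i j (bump (clash p i j) b)
    check-correct p i j b with nth bs p | nth bs i | nth bs j
    ... | true  | true  | true  = refl
    ... | true  | true  | false = refl
    ... | true  | false | true  = refl
    ... | true  | false | false = refl
    ... | false | true  | true  = refl
    ... | false | true  | false = refl
    ... | false | false | true  = refl
    ... | false | false | false = refl

    advance-wrap : ∀ p i j b → suc j ≤ L → suc i ≤ L → suc j ≡ k → sem advance (st p i j b) ≡ st p (suc i) 0 b
    advance-wrap p i j b j<L i<L e rewrite m≤n⇒m⊓n≡m j<L | e | ≡ᵇ-refl k | m≤n⇒m⊓n≡m i<L = refl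

    advance-next : ∀ p i j b → suc j ≤ L → suc j ≢ k → sem advance (st p i j b) ≡ st p i (suc j) b
    advance-next p i j b j<L ne rewrite m≤n⇒m⊓n≡m j<L | ≢⇒≡ᵇ-false (suc j) k ne = refl

    -- For `k = 0` the column index never wraps around, so apart from the equation for the position
    -- everything is claimed for positive `k` only.
    record Inv (m : ℕ) (τ : Vec ℕ 16) : Set where
      constructor inv
      field
        i j b  : ℕ
        τ≡     : τ ≡ st m i j b
        split  : i * k + j ≡ m
        below  : 0 < k → j < k
        sound  : 0 < k → b ≡ 0 → RankOne k m
        compl  : 0 < k → RankOne k m → b ≡ 0

    -- Since `0 < L`, saturation never turns a positive clash counter back to 0.
    bump≡0 : ∀ c b → bump c b ≡ 0 → c ≡ false × b ≡ 0
    bump≡0 false b e = refl , e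
    bump≡0 true b e = ⊥-elim (<⇒≢ (⊓-glb (s≤s z≤n) L>0) (sym e))

    module _ (m i j b : ℕ) (split : i * k + j ≡ m) (j<k : j < k) where
      extend : (b ≡ 0 → RankOne k m) → bump (clash m i j) b ≡ 0 → RankOne k (suc m)
      extend h e u v v<k (s≤s uv≤m) with bump≡0 (clash m i j) b e | u * k + v ≟ m
      ... | c≡f , b≡0 | no ne = h b≡0 u v v<k (≤∧≢⇒< uv≤m ne)
      -- Position `m` has a single decomposition with remainder below `k`, so the clash test just
      -- made concerns this very pair.
      ... | c≡f , b≡0 | yes refl with divMod-unique k u v i j v<k j<k (sym split)
      ...   | refl , refl = xor-false⇒≡ _ _ c≡f

      restrict : (RankOne k m → b ≡ 0) → RankOne k (suc m) → bump (clash m i j) b ≡ 0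
      restrict h g with clash m i j in c
      ... | false = h (λ u v v<k l → g u v v<k (m<n⇒m<1+n l))
      ... | true with trans (sym c) (trans (cong (_xor (β i xor β j)) eq₁) (xor-same (β i xor β j)))
        where
        eq₁ : β m ≡ β i xor β j
        eq₁ = trans (cong β (sym split)) (g i j j<k (s≤s (≤-reflexive split)))
      ...   | ()

    scan-step : ∀ m τ → m < L → Inv m τ → Inv (suc m) (proj₂ (eval (inc rpos) (sem scan τ)))
    scan-step m .(st m i j b) m<L (inv i j b refl split below sound compl) = result
      where
      b' = bump (clash m i j) b
      j<L : suc j ≤ L
      j<L = ≤-trans (s≤s (≤-trans (m≤n+m j (i * k)) (≤-reflexive split))) m<L
      tick' : ∀ {σ i' j'} → σ ≡ st m i' j' b' → proj₂ (eval (inc rpos) σ) ≡ st (suc m) i' j' b'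
      tick' refl rewrite m≤n⇒m⊓n≡m m<L = refl
      snd : 0 < k → b' ≡ 0 → RankOne k (suc m)
      snd k>0 = extend m i j b split (below k>0) (sound k>0)
      cmp : 0 < k → RankOne k (suc m) → b' ≡ 0
      cmp k>0 = restrict m i j b split (below k>0) (compl k>0)
      result : Inv (suc m) (proj₂ (eval (inc rpos) (sem scan (st m i j b))))
      result with suc j ≟ k
      ... | yes e = inv (suc i) 0 b'
              (tick' (trans (cong (sem advance) (check-correct m i j b)) (advance-wrap m i j b' j<L i<L e)))
              split' (λ k>0 → k>0) snd cmp
        where
        split' : suc i * k + 0 ≡ suc m
        split' = trans (+-identityʳ _) (trans (cong (_+ i * k) (sym e)) (cong suc (trans (+-comm j (i * k)) split)))
        -- The increment of `ri` is not capped, because `suc i` is at most `suc i * k`, which here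
        -- is `suc m`.
        i<L : suc i ≤ L
        i<L = ≤-trans (≤-trans (≤-reflexive (sym (*-identityʳ (suc i)))) (*-monoʳ-≤ (suc i) (≤-trans (s≤s z≤n) (≤-reflexive e))))
                      (≤-trans (≤-reflexive (trans (sym (+-identityʳ (suc i * k))) split')) m<L)
      ... | no ne = inv i (suc j) b'
              (tick' (trans (cong (sem advance) (check-correct m i j b)) (advance-next m i j b' j<L ne)))
              (trans (+-suc (i * k) j) (cong suc split)) (λ k>0 → ≤∧≢⇒< (below k>0) ne) snd cmp

    scanned : ∀ p i j b → Inv L (sem (op (clr ri) ⨾ op (clr rj) ⨾ op (clr rbad) ⨾ loop rpos scan) (st p i j b))
    scanned p i j b = loop-rule rpos scan (st p 0 0 0) Inv
      (inv 0 0 0 refl refl (λ k>0 → k>0) (λ _ _ _ _ _ ()) (λ _ _ → refl)) scan-step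

  zeros ones : ℕ → ℕ
  zeros = count (not ∘ β)
  ones  = count β

  Balanced : ℕ → Set
  Balanced n = ones n ≤ 2 ^ zeros n × zeros n ≤ 2 ^ ones n

  -- Records what later candidates must preserve: the constants 0 and 2 and the answer `a`. All
  -- other registers are left arbitrary, except that the first holds `k`.
  record Outcome (Accept : Set) (k : ℕ) (τ : Vec ℕ 16) : Set where
    constructor outcome
    field
      p f j b a : ℕ
      rest      : Vec ℕ 8
      τ≡        : τ ≡ k ∷ p ∷ f ∷ j ∷ b ∷ 0 ∷ 2 ∷ a ∷ rest
      ruling    : (a ≡ 1 × Accept) ⊎ (a ≡ 0 × ¬ Accept)

  module Census (n : ℕ) (n<L : n < L) (j b : ℕ) where

    L>0 : 0 < L
    L>0 = ≤-trans (s≤s z≤n) n<L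

    mk : (p f s t x x' y y' c m : ℕ) → Vec ℕ 16
    mk p f s t x x' y y' c m = n ∷ p ∷ f ∷ j ∷ b ∷ 0 ∷ 2 ∷ 0 ∷ s ∷ t ∷ x ∷ x' ∷ y ∷ y' ∷ c ∷ m ∷ []

    st : (p f q : ℕ) → Vec ℕ 16
    st p f q = mk p f (zeros q) (ones q) X X Y Y 0 0
      where
      X = 2 ^ zeros q ⊓ L
      Y = 2 ^ ones q ⊓ L

    next-pos : ∀ {σ p f q} → σ ≡ st p f q → p < L → proj₂ (eval (inc rpos) σ) ≡ st (suc p) f q
    next-pos refl p<L rewrite m≤n⇒m⊓n≡m p<L = refl

    doubleX : ∀ p f s t x y → x ≤ L →
      sem (double rX rX' rc rm) (mk p f s t x x y y 0 0) ≡ mk p f s t ((x + x) ⊓ L) ((x + x) ⊓ L) y y 0 0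
    doubleX p f s t x y x≤L = double-correct {rX} {rX'} {rc} {rm} {λ x x' c m → mk p f s t x x' y y c m}
      (record { getX = refl ; getW = refl ; getC = refl ; getM = refl
              ; setX = λ _ → refl ; setW = λ _ → refl ; setC = λ _ → refl ; setM = λ _ → refl }) x 0 0 x≤L

    doubleY : ∀ p f s t x y → y ≤ L →
      sem (double rY rY' rc rm) (mk p f s t x x y y 0 0) ≡ mk p f s t x x ((y + y) ⊓ L) ((y + y) ⊓ L) 0 0
    doubleY p f s t x y y≤L = double-correct {rY} {rY'} {rc} {rm} {λ y y' c m → mk p f s t x x y y' c m}
      (record { getX = refl ; getW = refl ; getC = refl ; getM = refl
              ; setX = λ _ → refl ; setW = λ _ → refl ; setC = λ _ → refl ; setM = λ _ → refl }) y 0 0 y≤L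

    countBit-correct : ∀ q → q < L → sem countBit (st q 0 q) ≡ st q 0 (suc q)
    countBit-correct q q<L with nth bs q
    ... | true  = trans
          (doubleY q 0 (zeros q) (suc (ones q) ⊓ L) (2 ^ zeros q ⊓ L) (2 ^ ones q ⊓ L) (m⊓n≤n _ L))
          (cong₂ (λ t y → mk q 0 (zeros q) t (2 ^ zeros q ⊓ L) (2 ^ zeros q ⊓ L) y y 0 0)
            (m≤n⇒m⊓n≡m (≤-trans (s≤s (count≤ β q)) q<L)) (double-⊓ (2 ^ ones q) L))
    ... | false = trans
          (doubleX q 0 (suc (zeros q) ⊓ L) (ones q) (2 ^ zeros q ⊓ L) (2 ^ ones q ⊓ L) (m⊓n≤n _ L))
          (cong₂ (λ s x → mk q 0 s (ones q) x x (2 ^ ones q ⊓ L) (2 ^ ones q ⊓ L) 0 0)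
            (m≤n⇒m⊓n≡m (≤-trans (s≤s (count≤ (not ∘ β) q)) q<L)) (double-⊓ (2 ^ zeros q) L))

    -- Either the position has not gone past `n` and the counts are those of the first `q` bits, or
    -- row 0 has been left, the flag is 1 and the counts are frozen.
    Inv : ℕ → Vec ℕ 16 → Set
    Inv q τ = (q ≤ n × τ ≡ st q 0 q) ⊎ (n < q × τ ≡ st q 1 n)

    tally-step : ∀ q τ → q < L → Inv q τ → Inv (suc q) (proj₂ (eval (inc rpos) (sem tally τ)))
    tally-step q _ q<L (inj₁ (q≤n , refl)) with q ≟ n
    ... | no q≢n = inj₁ (≤∧≢⇒< q≤n q≢n , next-pos {q = suc q}
          (trans (cong (sem tallyRow) (ite-≢ rpos rk (op (inc ri)) (skip rk) (st q 0 q) q≢n))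
                 (countBit-correct q q<L)) q<L)
    ... | yes refl = inj₂ (≤-refl , next-pos {q = n}
          (trans (cong (sem tallyRow) (ite-eq rpos rk (op (inc ri)) (skip rk) (st q 0 q) refl))
                 (cong (λ z → sem tallyRow (st q z q)) (m≤n⇒m⊓n≡m {1} L>0))) q<L)
    tally-step q _ q<L (inj₂ (n<q , refl)) = inj₂ (m<n⇒m<1+n n<q , next-pos {q = n}
          (cong (sem tallyRow) (ite-≢ rpos rk (op (inc ri)) (skip rk) (st q 1 n) (<⇒≢ n<q ∘ sym))) q<L)

    tallied : ∀ p → sem (loop rpos tally) (mk p 0 0 0 1 1 1 1 0 0) ≡ st L 1 n
    tallied p with loop-rule rpos tally (mk p 0 0 0 1 1 1 1 0 0) Inv
        (inj₁ (z≤n , cong (λ z → mk 0 0 0 0 z z z z 0 0) (sym (m≤n⇒m⊓n≡m {1} L>0)))) tally-step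
    ... | inj₁ (L≤n , _) = ⊥-elim (<⇒≱ n<L L≤n)
    ... | inj₂ (_ , e)   = e

    -- Neither count exceeds `L`, so being below a power of two and being below its capped value are
    -- the same.
    census-correct : ∀ p f → Outcome (Balanced n) n (sem census (mk p f 0 0 0 0 0 0 0 0))
    census-correct p f = subst (Outcome (Balanced n) n) (sym reach) final
      where
      Z O X Y : ℕ
      Z = zeros n
      O = ones n
      X = 2 ^ Z ⊓ L
      Y = 2 ^ O ⊓ L
      n≤L = <⇒≤ n<L
      minX : sem (minimum rX rt rc rm) (st L 1 n) ≡ mk L 1 Z O X X Y Y (O ⊓ X) L
      minX = minimum-correct {rX} {rt} {rc} {rm} {λ x t c m → mk L 1 Z t x X Y Y c m}
        (record { getX = refl ; getW = refl ; getC = refl ; getM = refl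
                ; setX = λ _ → refl ; setW = λ _ → refl ; setC = λ _ → refl ; setM = λ _ → refl })
        X O 0 0 (≤-trans (count≤ β n) n≤L)
      minY : ∀ c m → sem (minimum rY rs rc rm) (mk L 1 Z O X X Y Y c m) ≡ mk L 1 Z O X X Y Y (Z ⊓ Y) L
      minY c m = minimum-correct {rY} {rs} {rc} {rm} {λ y s c m → mk L 1 s O X X y Y c m}
        (record { getX = refl ; getW = refl ; getC = refl ; getM = refl
                ; setX = λ _ → refl ; setW = λ _ → refl ; setC = λ _ → refl ; setM = λ _ → refl })
        Y Z c m (≤-trans (count≤ (not ∘ β) n) n≤L)
      reach : sem census (mk p f 0 0 0 0 0 0 0 0) ≡ sem compareOnes (mk L 1 Z O X X Y Y (O ⊓ X) L)
      reach = trans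
        (cong (λ z → sem (loop rpos tally ⨾ minimum rX rt rc rm ⨾ compareOnes) (mk p 0 0 0 z z z z 0 0)) (m≤n⇒m⊓n≡m {1} L>0))
        (trans (cong (sem (minimum rX rt rc rm ⨾ compareOnes)) (tallied p)) (cong (sem compareOnes) minX))
      final : Outcome (Balanced n) n (sem compareOnes (mk L 1 Z O X X Y Y (O ⊓ X) L))
      final with O ⊓ X ≟ O
      ... | no ne = outcome L 1 j b 0 _
              (ite-≢ rc rt (minimum rY rs rc rm ⨾ compareZeros) (skip rk) (mk L 1 Z O X X Y Y (O ⊓ X) L) ne)
              (inj₂ (refl , λ (O≤ , _) → ne (m≤n⇒m⊓n≡m (⊓-glb O≤ (≤-trans (count≤ β n) n≤L)))))
      ... | yes e = subst (Outcome (Balanced n) n) (sym step₁) final₂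
        where
        O≤ : O ≤ 2 ^ Z
        O≤ = ≤-trans (m⊓n≡m⇒m≤n e) (m⊓n≤m (2 ^ Z) L)
        σ : Vec ℕ 16
        σ = mk L 1 Z O X X Y Y (Z ⊓ Y) L
        step₁ : sem compareOnes (mk L 1 Z O X X Y Y (O ⊓ X) L) ≡ sem compareZeros σ
        step₁ = trans (ite-eq rc rt (minimum rY rs rc rm ⨾ compareZeros) (skip rk) (mk L 1 Z O X X Y Y (O ⊓ X) L) e)
                      (cong (sem compareZeros) (minY (O ⊓ X) L))
        final₂ : Outcome (Balanced n) n (sem compareZeros σ)
        final₂ with Z ⊓ Y ≟ Z
        ... | no ne = outcome L 1 j b 0 _ (ite-≢ rc rs (op (inc rans)) (skip rk) σ ne)
                (inj₂ (refl , λ (_ , Z≤) → ne (m≤n⇒m⊓n≡m (⊓-glb Z≤ (≤-trans (count≤ (not ∘ β) n) n≤L)))))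
        ... | yes e' = outcome L 1 j b (1 ⊓ L) _ (ite-eq rc rs (op (inc rans)) (skip rk) σ e')
                (inj₁ (m≤n⇒m⊓n≡m L>0 , O≤ , ≤-trans (m⊓n≡m⇒m≤n e') (m⊓n≤m (2 ^ O) L)))

  module Decide (n : ℕ) (n≥2 : 2 ≤ n) (n² : n * n ≡ L) where

    -- Strictness matters twice: the candidates `k < L` include `n`, and the census passes position
    -- `n`, where it sets its flag.
    n<L : n < L
    n<L = <-≤-trans (m<m+n n {n} (≤-trans (s≤s z≤n) n≥2))
      (≤-trans (≤-reflexive (cong (n +_) (sym (+-identityʳ n)))) (≤-trans (*-monoˡ-≤ n n≥2) (≤-reflexive n²)))

    L>0 : 0 < L
    L>0 = ≤-trans (s≤s z≤n) n<L

    Accept : Set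
    Accept = RankOne n L × n ≢ 2 × Balanced n

    validate-other : ∀ k p i j b rest → Dec (i ≡ k) → Dec (j ≡ 0) → ¬ (i ≡ k × j ≡ 0) →
      sem validate (k ∷ p ∷ i ∷ j ∷ b ∷ 0 ∷ rest) ≡ k ∷ p ∷ i ∷ j ∷ b ∷ 0 ∷ rest
    validate-other k p i j b rest (no ne) _ h =
      ite-≢ ri rk (ite (eq rj rzero) checkBad (skip rk)) (skip rk) (k ∷ p ∷ i ∷ j ∷ b ∷ 0 ∷ rest) ne
    validate-other k p i j b rest (yes e) (no ne) h = trans
      (ite-eq ri rk (ite (eq rj rzero) checkBad (skip rk)) (skip rk) (k ∷ p ∷ i ∷ j ∷ b ∷ 0 ∷ rest) e)
      (ite-≢ rj rzero checkBad (skip rk) (k ∷ p ∷ i ∷ j ∷ b ∷ 0 ∷ rest) ne)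
    validate-other k p i j b rest (yes e) (yes e') h = ⊥-elim (h (e , e'))

    Unchanged : ℕ → Vec ℕ 10 → Vec ℕ 16 → Set
    Unchanged k rest τ = ∃ λ p → ∃ λ i → ∃ λ j → ∃ λ b → τ ≡ k ∷ p ∷ i ∷ j ∷ b ∷ 0 ∷ rest

    -- Stopping at `i = k`, `j = 0` would give `k * k = L = n * n` and hence `k = n`; a wrong
    -- candidate therefore never gets beyond the two position tests.
    validate-unchanged : ∀ k rest τ → k ≢ n → Scan.Inv k rest L>0 L τ → Unchanged k rest (sem validate τ)
    validate-unchanged k rest _ k≢n (Scan.inv i j b refl split _ _ _) = L , i , j , b ,
      validate-other k L i j b rest (i ≟ k) (j ≟ 0)
        (λ { (refl , refl) → k≢n (square-injective k n (trans (sym (+-identityʳ (k * k))) (trans split (sym n²)))) })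

    attempt-other : ∀ k rest τ → k ≢ n → Unchanged k rest τ → Unchanged k rest (sem attempt τ)
    attempt-other k rest _ k≢n (p , i , j , b , refl) =
      validate-unchanged k rest _ k≢n (Scan.scanned k rest L>0 p i j b)

    untouched : Vec ℕ 10
    untouched = 2 ∷ replicate 9 0

    final : ℕ → Vec ℕ 16
    final b = n ∷ L ∷ n ∷ 0 ∷ b ∷ 0 ∷ untouched

    n>0 : 0 < n
    n>0 = ≤-trans (s≤s z≤n) n≥2

    outcome-map : ∀ {A B k τ υ} → υ ≡ τ → (A → B) → (B → A) → Outcome A k τ → Outcome B k υ
    outcome-map refl f g (outcome p i j b a rest e (inj₁ (a≡1 , x)))  = outcome p i j b a rest e (inj₁ (a≡1 , f x))
    outcome-map refl f g (outcome p i j b a rest e (inj₂ (a≡0 , ¬x))) = outcome p i j b a rest e (inj₂ (a≡0 , ¬x ∘ g))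

    judge : ∀ b → (b ≡ 0 → RankOne n L) → (RankOne n L → b ≡ 0) → Dec (b ≡ 0) → Dec (n ≡ 2) →
            Outcome Accept n (sem checkBad (final b))
    judge b sound compl (no b≢0) _ = outcome L n 0 b 0 _
      (ite-≢ rbad rzero checkSize (skip rk) (final b) b≢0) (inj₂ (refl , λ (r , _) → b≢0 (compl r)))
    judge b sound compl (yes b≡0) (yes n≡2) = outcome L n 0 b 0 _
      (trans (ite-eq rbad rzero checkSize (skip rk) (final b) b≡0) (ite-eq rk rtwo (skip rk) census (final b) n≡2))
      (inj₂ (refl , λ (_ , n≢2 , _) → n≢2 n≡2))
    judge b sound compl (yes b≡0) (no n≢2) = outcome-map
      (trans (ite-eq rbad rzero checkSize (skip rk) (final b) b≡0) (ite-≢ rk rtwo (skip rk) census (final b) n≢2))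
      (λ bal → sound b≡0 , n≢2 , bal) (λ (_ , _ , bal) → bal)
      (Census.census-correct n n<L 0 b L n)

    validate-n : ∀ τ → Scan.Inv n untouched L>0 L τ → Outcome Accept n (sem validate τ)
    validate-n _ (Scan.inv i j b refl split below sound compl) =
      go (divMod-unique n i j n 0 (below n>0) n>0 (trans split (trans (sym n²) (sym (+-identityʳ (n * n))))))
      where
      go : i ≡ n × j ≡ 0 → Outcome Accept n (sem validate (n ∷ L ∷ i ∷ j ∷ b ∷ 0 ∷ untouched))
      go (refl , refl) = outcome-map
        (trans (ite-eq ri rk (ite (eq rj rzero) checkBad (skip rk)) (skip rk) (final b) refl)
               (ite-eq rj rzero checkBad (skip rk) (final b) refl))
        (λ x → x) (λ x → x) (judge b (sound n>0) (compl n>0) (b ≟ 0) (n ≟ 2))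

    attempt-n : ∀ τ → Unchanged n untouched τ → Outcome Accept n (sem attempt τ)
    attempt-n _ (p , i , j , b , refl) = validate-n _ (Scan.scanned n untouched L>0 p i j b)

    Inv : ℕ → Vec ℕ 16 → Set
    Inv k τ = (k ≤ n × Unchanged k untouched τ) ⊎ (n < k × Outcome Accept k τ)

    next-k : ∀ {k xs} σ → k < L → σ ≡ k ∷ xs → proj₂ (eval (inc rk) σ) ≡ suc k ∷ xs
    next-k _ k<L refl = cong (_∷ _) (m≤n⇒m⊓n≡m k<L)

    unchanged-next : ∀ {k rest} σ → k < L → Unchanged k rest σ → Unchanged (suc k) rest (proj₂ (eval (inc rk) σ))
    unchanged-next σ k<L (p , i , j , b , e) = p , i , j , b , next-k σ k<L e

    outcome-next : ∀ {k} σ → k < L → Outcome Accept k σ → Outcome Accept (suc k) (proj₂ (eval (inc rk) σ))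
    outcome-next σ k<L (outcome p f j b a rest e v) = outcome p f j b a rest (next-k σ k<L e) v

    attempt-step : ∀ k τ → k < L → Inv k τ → Inv (suc k) (proj₂ (eval (inc rk) (sem attempt τ)))
    attempt-step k τ k<L (inj₁ (k≤n , u)) = go (k ≟ n)
      where
      go : Dec (k ≡ n) → Inv (suc k) (proj₂ (eval (inc rk) (sem attempt τ)))
      go (no k≢n)   = inj₁ (≤∧≢⇒< k≤n k≢n , unchanged-next (sem attempt τ) k<L (attempt-other k untouched τ k≢n u))
      go (yes refl) = inj₂ (≤-refl , outcome-next (sem attempt τ) k<L (attempt-n τ u))
    attempt-step k τ k<L (inj₂ (n<k , outcome p f j b a rest e v)) =
      inj₂ (m<n⇒m<1+n n<k , outcome-next (sem attempt τ) k<L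
        (go (attempt-other k (2 ∷ a ∷ rest) τ (<⇒≢ n<k ∘ sym) (p , f , j , b , e))))
      where
      go : Unchanged k (2 ∷ a ∷ rest) (sem attempt τ) → Outcome Accept k (sem attempt τ)
      go (p' , f' , j' , b' , e') = outcome p' f' j' b' a rest e' v

    registers : Vec ℕ 16
    registers = sem decider (replicate 16 0)

    decider-correct : Outcome Accept L registers
    decider-correct = subst (λ z → Outcome Accept L (sem (loop rk attempt) z)) (sym two)
      (conclude (loop-rule rk attempt start Inv (inj₁ (z≤n , 0 , 0 , 0 , 0 , refl)) attempt-step))
      where
      start : Vec ℕ 16
      start = 0 ∷ 0 ∷ 0 ∷ 0 ∷ 0 ∷ 0 ∷ untouched
      two : sem (op (inc rtwo) ⨾ op (inc rtwo)) (replicate 16 0) ≡ start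
      two = cong (λ z → 0 ∷ 0 ∷ 0 ∷ 0 ∷ 0 ∷ 0 ∷ z ∷ replicate 9 0)
        (trans (cong (λ z → suc z ⊓ L) (m≤n⇒m⊓n≡m L>0)) (m≤n⇒m⊓n≡m (≤-trans n≥2 (<⇒≤ n<L))))
      conclude : ∀ {τ} → Inv L τ → Outcome Accept L τ
      conclude (inj₁ (L≤n , _)) = ⊥-elim (<⇒≱ n<L L≤n)
      conclude (inj₂ (_ , o))   = o

    outcome-sound : ∀ {A k τ} → Outcome A k τ → verdict rans rzero τ ≡ true → A
    outcome-sound (outcome _ _ _ _ _ _ _ (inj₁ (_ , acc))) _ = acc
    outcome-sound (outcome _ _ _ _ _ _ refl (inj₂ (refl , _))) ()

    outcome-complete : ∀ {A k τ} → Outcome A k τ → A → verdict rans rzero τ ≡ true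
    outcome-complete (outcome _ _ _ _ _ _ refl (inj₁ (refl , _))) _ = refl
    outcome-complete (outcome _ _ _ _ _ _ _ (inj₂ (_ , ¬acc))) acc = ⊥-elim (¬acc acc)

-- The adjacency matrix inside its encoding

at-++ˡ : ∀ xs ys p → p < length xs → at (xs ++ ys) p ≡ at xs p
at-++ˡ (x ∷ xs) ys zero    _       = refl
at-++ˡ (x ∷ xs) ys (suc p) (s≤s h) = at-++ˡ xs ys p h

at-++ʳ : ∀ xs ys p → at (xs ++ ys) (length xs + p) ≡ at ys p
at-++ʳ []       ys p = refl
at-++ʳ (x ∷ xs) ys p = at-++ʳ xs ys p

at-map-tabulate : ∀ {A : Set} {m} (f : A → Bool) (g : Fin m → A) v → at (List.map f (tabulate g)) (toℕ v) ≡ just (f (g v))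
at-map-tabulate f g zero    = refl
at-map-tabulate f g (suc v) = at-map-tabulate f (g ∘ suc) v

at-concatMap : ∀ {A : Set} {m} n (f : A → List Bool) → (∀ a → length (f a) ≡ n) → ∀ (g : Fin m → A) u p → p < n →
               at (concatMap f (tabulate g)) (toℕ u * n + p) ≡ at (f (g u)) p
at-concatMap n f h g zero p p<n = at-++ˡ (f (g zero)) _ p (subst (p <_) (sym (h _)) p<n)
at-concatMap n f h g (suc u) p p<n =
  trans (cong (at (concatMap f (tabulate g))) (trans (+-assoc n (toℕ u * n) p) (cong (_+ (toℕ u * n + p)) (sym (h (g zero))))))
  (trans (at-++ʳ (f (g zero)) _ (toℕ u * n + p)) (at-concatMap n f h (g ∘ suc) u p p<n))

length-concatMap-tabulate : ∀ {A : Set} {m} n (f : A → List Bool) → (∀ a → length (f a) ≡ n) → ∀ (g : Fin m → A) →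
                            length (concatMap f (tabulate g)) ≡ m * n
length-concatMap-tabulate {m = zero}  n f h g = refl
length-concatMap-tabulate {m = suc m} n f h g =
  trans (length-++ (f (g zero))) (cong₂ _+_ (h (g zero)) (length-concatMap-tabulate n f h (g ∘ suc)))

module _ (G : Graph) where
  open Graph G

  length-row : ∀ u → length (List.map (adj u) (allFin n)) ≡ n
  length-row u = trans (length-map (adj u) (allFin n)) (length-tabulate {n = n} id)

  length-encode : length (encode G) ≡ n * n
  length-encode = length-concatMap-tabulate n (λ u → List.map (adj u) (allFin n)) length-row id

  nth-encode : ∀ u v → nth (encode G) (toℕ u * n + toℕ v) ≡ adj u v
  nth-encode u v = cong (fromMaybe false)
    (trans (at-concatMap n (λ u → List.map (adj u) (allFin n)) length-row id u (toℕ v) (toℕ<n v))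
           (at-map-tabulate (adj u) id v))

-- Binary matrices with distinct rows and distinct columns

Matrix : ℕ → ℕ → Set
Matrix m n = Fin m → Fin n → Fin 2

DistinctRows : ∀ {m n} → Matrix m n → Set
DistinctRows M = ∀ i i' → i ≢ i' → ∃ λ j → M i j ≢ M i' j

transpose : ∀ {m n} → Matrix m n → Matrix n m
transpose M j i = M i j

funToFin-cong : ∀ {m n} {f g : Fin m → Fin n} → (∀ i → f i ≡ g i) → funToFin f ≡ funToFin g
funToFin-cong {zero}  h = refl
funToFin-cong {suc m} h = cong₂ combine (h zero) (funToFin-cong (h ∘ suc))

-- Read as binary numerals by `funToFin`, the rows inject into `Fin (2 ^ n)`.
distinctRows⇒≤ : ∀ {m n} (M : Matrix m n) → DistinctRows M → m ≤ 2 ^ n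
distinctRows⇒≤ {m} {n} M d = injective⇒≤ {f = funToFin ∘ M} inj
  where
  inj : ∀ {i i'} → funToFin (M i) ≡ funToFin (M i') → i ≡ i'
  inj {i} {i'} e with i Fin.≟ i'
  ... | yes i≡i' = i≡i'
  ... | no i≢i'  = let (j , ne) = d i i' i≢i' in
    ⊥-elim (ne (trans (sym (finToFun-funToFin (M i) j)) (trans (cong (λ z → finToFun z j) e) (finToFun-funToFin (M i') j))))

Separating : ℕ → ℕ → Set
Separating m n = Σ (Matrix m n) λ M → DistinctRows M × DistinctRows (transpose M)

identity-separating : ∀ n → Separating n n
identity-separating n = I , rows , λ j j' ne → j , λ e → rows-at j j' ne (trans (I-comm j j) (trans e (I-comm j j')))
  where
  I : Matrix n n
  I i j with i Fin.≟ j
  ... | yes _ = suc zero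
  ... | no _  = zero
  I-comm : ∀ i j → I i j ≡ I j i
  I-comm i j with i Fin.≟ j | j Fin.≟ i
  ... | yes _ | yes _ = refl
  ... | no _  | no _  = refl
  ... | yes e | no ne = ⊥-elim (ne (sym e))
  ... | no ne | yes e = ⊥-elim (ne (sym e))
  rows-at : ∀ i i' → i ≢ i' → I i i ≢ I i' i
  rows-at i i' ne with i Fin.≟ i | i' Fin.≟ i
  ... | no ≢   | _     = ⊥-elim (≢ refl)
  ... | yes _  | yes e = ⊥-elim (ne (sym e))
  ... | yes _  | no _  = λ ()
  rows : DistinctRows I
  rows i i' ne = i , rows-at i i' ne

-- If every code were taken, choosing a row for each code would inject `Fin (2 ^ n)` into `Fin m`.
-- The search is finite, so a missed code can be exhibited.
fresh-row : ∀ {m n} (M : Matrix m n) → m < 2 ^ n → ∃ λ (x : Fin n → Fin 2) → ∀ i → ∃ λ j → x j ≢ M i j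
fresh-row {m} {n} M m<2ⁿ with all? (λ y → any? (λ i → funToFin (M i) Fin.≟ y))
... | yes pre = ⊥-elim (<⇒≱ m<2ⁿ (injective⇒≤ {f = proj₁ ∘ pre}
      (λ {y} {y'} e → trans (sym (proj₂ (pre y))) (trans (cong (funToFin ∘ M) e) (proj₂ (pre y'))))))
... | no ¬pre with ¬∀⟶∃¬ _ _ (λ y → any? (λ i → funToFin (M i) Fin.≟ y)) ¬pre
...   | y , missed = finToFun y , λ i → ¬∀⟶∃¬ n _ (λ j → finToFun y j Fin.≟ M i j)
        (λ same → missed (i , trans (sym (funToFin-cong same)) (funToFin-finToFin {n} y)))

-- Columns that differ in an old row still differ there, so only the rows need attention.
add-row : ∀ {m n} → m < 2 ^ n → Separating m n → Separating (suc m) n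
add-row {m} {n} m<2ⁿ (M , rows , cols) = M' , rows' , λ j j' ne → let (i , h) = cols j j' ne in suc i , h
  where
  x = proj₁ (fresh-row M m<2ⁿ)
  M' : Matrix (suc m) n
  M' zero    = x
  M' (suc i) = M i
  rows' : DistinctRows M'
  rows' zero    zero     ne = ⊥-elim (ne refl)
  rows' zero    (suc i)  ne = proj₂ (fresh-row M m<2ⁿ) i
  rows' (suc i) zero     ne = let (j , h) = proj₂ (fresh-row M m<2ⁿ) i in j , h ∘ sym
  rows' (suc i) (suc i') ne = rows i i' (ne ∘ cong suc)

separating-tall : ∀ m n → n ≤ m → m ≤ 2 ^ n → Separating m n
separating-tall m n n≤m m≤ with m≤n⇒m<n∨m≡n n≤m
... | inj₂ refl = identity-separating n
separating-tall (suc m) n n≤m m≤ | inj₁ (s≤s n≤m') = add-row m≤ (separating-tall m n n≤m' (<⇒≤ m≤))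

separating : ∀ m n → m ≤ 2 ^ n → n ≤ 2 ^ m → Separating m n
separating m n m≤ n≤ with ≤-total n m
... | inj₁ n≤m = separating-tall m n n≤m m≤
... | inj₂ m≤n = let (M , rows , cols) = separating-tall n m m≤n n≤ in transpose M , cols , rows

-- Enumerating a class of vertices

record Enumeration {n : ℕ} (P : Fin n → Bool) (c : ℕ) : Set where
  field
    elem      : Fin c → Fin n
    member    : ∀ i → P (elem i) ≡ true
    injective : ∀ i i' → elem i ≡ elem i' → i ≡ i'
    index     : ∀ u → P u ≡ true → ∃ λ i → elem i ≡ u

-- The members are listed from the largest down, following the recursion of `count`.
enumerate : ∀ n (f : ℕ → Bool) → Enumeration {n} (f ∘ toℕ) (count f n)
enumerate n f = record
  { elem = λ i → fromℕ< (bound n i)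
  ; member = λ i → trans (cong f (toℕ-fromℕ< (bound n i))) (holds n i)
  ; injective = λ i i' e → inj n i i' (trans (sym (toℕ-fromℕ< (bound n i))) (trans (cong toℕ e) (toℕ-fromℕ< (bound n i'))))
  ; index = λ u h → let (i , e) = find n (toℕ u) (toℕ<n u) h in i , toℕ-injective (trans (toℕ-fromℕ< (bound n i)) e)
  }
  where
  val : ∀ n → Fin (count f n) → ℕ
  val (suc n) i with f n
  val (suc n) zero    | true  = n
  val (suc n) (suc i) | true  = val n i
  val (suc n) i       | false = val n i
  bound : ∀ n i → val n i < n
  bound (suc n) i with f n
  bound (suc n) zero    | true  = ≤-refl
  bound (suc n) (suc i) | true  = m<n⇒m<1+n (bound n i)
  bound (suc n) i       | false = m<n⇒m<1+n (bound n i)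
  holds : ∀ n i → f (val n i) ≡ true
  holds (suc n) i with f n in e
  holds (suc n) zero    | true  = e
  holds (suc n) (suc i) | true  = holds n i
  holds (suc n) i       | false = holds n i
  inj : ∀ n i i' → val n i ≡ val n i' → i ≡ i'
  inj (suc n) i i' e with f n
  inj (suc n) zero    zero     e | true  = refl
  inj (suc n) zero    (suc i') e | true  = ⊥-elim (<⇒≢ (bound n i') (sym e))
  inj (suc n) (suc i) zero     e | true  = ⊥-elim (<⇒≢ (bound n i) e)
  inj (suc n) (suc i) (suc i') e | true  = cong suc (inj n i i' e)
  inj (suc n) i       i'       e | false = inj n i i' e
  find : ∀ n q → q < n → f q ≡ true → ∃ λ i → val n i ≡ q
  find (suc n) q (s≤s q≤n) h with m≤n⇒m<n∨m≡n q≤n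
  find (suc n) q (s≤s q≤n) h | inj₁ q<n with find n q q<n h
  ... | i , e with f n
  ...   | true  = suc i , e
  ...   | false = i , e
  find (suc n) q (s≤s q≤n) h | inj₂ refl with f n
  find (suc n) q (s≤s q≤n) h  | inj₂ refl | true  = zero , refl
  find (suc n) q (s≤s q≤n) () | inj₂ refl | false

-- Rainbow connection with at most two colours

T⇒≡ : ∀ {b} → T b → b ≡ true
T⇒≡ {true} _ = refl

≡⇒T : ∀ {b} → b ≡ true → T b
≡⇒T refl = tt

module _ (G : Graph) where
  open Graph G

  data Short (c : Colouring G 2) (u v : Fin n) : Set where
    trivial : u ≡ v → Short c u v
    direct  : Adj G u v → Short c u v
    via     : ∀ w → Adj G u w → Adj G w v → Colouring.col c u w ≢ Colouring.col c w v → Short c u v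

  -- Applied both to the colours of three edges on a rainbow path and to three vertices of a graph
  -- on two vertices.
  no-three : ∀ {a b c : Fin 2} → a ≢ b → a ≢ c → b ≢ c → ⊥
  no-three {zero}     {zero}     ab ac bc = ab refl
  no-three {zero}     {suc zero} {zero}     ab ac bc = ac refl
  no-three {zero}     {suc zero} {suc zero} ab ac bc = bc refl
  no-three {suc zero} {zero}     {zero}     ab ac bc = bc refl
  no-three {suc zero} {zero}     {suc zero} ab ac bc = ac refl
  no-three {suc zero} {suc zero} ab ac bc = ab refl

  rainbow-short : ∀ c u v vs → RainbowPath G c u v vs → Short c u v
  rainbow-short c u v [] ((() , _) , _)
  rainbow-short c u v (x ∷ []) ((refl , refl , _) , _) = trivial refl
  rainbow-short c u v (x ∷ y ∷ []) ((refl , refl , (a , _) , _) , _) = direct a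
  rainbow-short c u v (x ∷ y ∷ z ∷ []) ((refl , refl , (a , a' , _) , _) , ((ne ∷ _) ∷ _)) = via y a a' ne
  rainbow-short c u v (x ∷ y ∷ z ∷ w ∷ r) (_ , ((ab ∷ ac ∷ _) ∷ (bc ∷ _) ∷ _)) = ⊥-elim (no-three ab ac bc)

  rainbow-one : ∀ (c : Colouring G 1) u v vs → RainbowPath G c u v vs → u ≡ v ⊎ Adj G u v
  rainbow-one c u v [] ((() , _) , _)
  rainbow-one c u v (x ∷ []) ((refl , refl , _) , _) = inj₁ refl
  rainbow-one c u v (x ∷ y ∷ []) ((refl , refl , (a , _) , _) , _) = inj₂ a
  rainbow-one c u v (x ∷ y ∷ z ∷ r) (_ , ((ne ∷ _) ∷ _)) with Colouring.col c x y | Colouring.col c y z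
  ... | zero | zero = ⊥-elim (ne refl)

  adj⇒≢ : ∀ {u v} → Adj G u v → u ≢ v
  adj⇒≢ {u} a refl = subst T (irrefl u) a

  path-one : ∀ {k} (c : Colouring G k) u → RainbowPath G c u u (u ∷ [])
  path-one c u = (refl , refl , tt , ([] ∷ [])) , []

  path-two : ∀ {k} (c : Colouring G k) u v → Adj G u v → RainbowPath G c u v (u ∷ v ∷ [])
  path-two c u v a = (refl , refl , (a , tt) , ((adj⇒≢ a ∷ []) ∷ [] ∷ [])) , ([] ∷ [])

  path-three : ∀ {k} (c : Colouring G k) u w v → u ≢ v → Adj G u w → Adj G w v →
               Colouring.col c u w ≢ Colouring.col c w v → RainbowPath G c u v (u ∷ w ∷ v ∷ [])
  path-three c u w v u≢v a a' ne =
    (refl , refl , (a , a' , tt) , ((adj⇒≢ a ∷ u≢v ∷ []) ∷ (adj⇒≢ a' ∷ []) ∷ [] ∷ [])) , ((ne ∷ []) ∷ [] ∷ [])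

  adj-two : n ≡ 2 → Connected G → ∀ u v → u ≢ v → Adj G u v
  adj-two n≡2 conn u v u≢v with conn u v
  ... | [] , () , _
  ... | x ∷ [] , refl , refl , _ = ⊥-elim (u≢v refl)
  ... | x ∷ y ∷ [] , refl , refl , (a , _) , _ = a
  ... | x ∷ y ∷ z ∷ r , _ , _ , _ , ((xy ∷ xz ∷ _) ∷ (yz ∷ _) ∷ _) =
    ⊥-elim (no-three (xy ∘ back) (xz ∘ back) (yz ∘ back))
    where
    back : ∀ {x y} → Fin.cast n≡2 x ≡ Fin.cast n≡2 y → x ≡ y
    back {x} {y} e = toℕ-injective (trans (sym (toℕ-cast n≡2 x)) (trans (cong toℕ e) (toℕ-cast n≡2 y)))

  rc≡2⇒n≢2 : Connected G → rc≡ G 2 → n ≢ 2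
  rc≡2⇒n≢2 conn (_ , least) n≡2 = least 1 ≤-refl (c , joined)
    where
    c : Colouring G 1
    c = record { col = λ _ _ → zero ; colSym = λ _ _ _ → refl }
    joined : RainbowConnected G c
    joined u v with u Fin.≟ v
    ... | yes refl = _ , path-one c u
    ... | no u≢v   = _ , path-two c u v (adj-two n≡2 conn u v u≢v)

  CompleteBipartite : (Fin n → Bool) → Set
  CompleteBipartite r = ∀ u v → adj u v ≡ r u xor r v

  -- Vertices on different sides cannot be joined by two edges, so they are adjacent. This gives the
  -- formula for the abstract bipartition `side`; row `z` equals `side` up to the constant `side z`,
  -- which cancels in the xor of two entries. The program can thus use a row of the matrix in place
  -- of `side`.
  rc≡2⇒complete : Bipartite G → RCWith G 2 → ∀ z → CompleteBipartite (adj z)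
  rc≡2⇒complete (side , proper) (c , joined) z u v =
    trans (complete u v) (trans (mix (side z) (side u) (side v)) (sym (cong₂ _xor_ (complete z u) (complete z v))))
    where
    mix : ∀ a b c → b xor c ≡ (a xor b) xor (a xor c)
    mix false b     c     = refl
    mix true  false false = refl
    mix true  false true  = refl
    mix true  true  false = refl
    mix true  true  true  = refl
    differ : ∀ a b → a ≢ b → a xor b ≡ true
    differ false false h = ⊥-elim (h refl)
    differ false true  h = refl
    differ true  false h = refl
    differ true  true  h = ⊥-elim (h refl)
    two-steps : ∀ {a b c : Bool} → a ≢ b → b ≢ c → a ≡ c
    two-steps {false} {false} ab bc = ⊥-elim (ab refl)
    two-steps {true}  {true}  ab bc = ⊥-elim (ab refl)
    two-steps {false} {true}  {false} ab bc = refl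
    two-steps {false} {true}  {true}  ab bc = ⊥-elim (bc refl)
    two-steps {true}  {false} {true}  ab bc = refl
    two-steps {true}  {false} {false} ab bc = ⊥-elim (bc refl)
    complete : CompleteBipartite side
    complete u v with adj u v in e
    ... | true = sym (differ _ _ (proper u v (≡⇒T e)))
    ... | false with joined u v
    ...   | vs , path with rainbow-short c u v vs path
    ...     | trivial refl   = sym (xor-same (side u))
    ...     | direct a       = ⊥-elim (subst T e a)
    ...     | via w a a' _   = sym (trans (cong (_xor side v) (two-steps (proper u w a) (proper w v a'))) (xor-same (side v)))

  module _ {s t : ℕ} (r : Fin n → Bool) (complete : CompleteBipartite r)
           (S : Enumeration (not ∘ r) s) (E : Enumeration r t) where
    private
      module S = Enumeration S
      module E = Enumeration E

    side-S : ∀ i → r (S.elem i) ≡ false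
    side-S i = not-true (S.member i)
      where
      not-true : ∀ {b} → not b ≡ true → b ≡ false
      not-true {false} _ = refl

    adj-ST : ∀ i j → Adj G (S.elem i) (E.elem j)
    adj-ST i j = ≡⇒T (trans (complete _ _) (cong₂ _xor_ (side-S i) (E.member j)))

    adj-TS : ∀ j i → Adj G (E.elem j) (S.elem i)
    adj-TS j i = ≡⇒T (trans (complete _ _) (cong₂ _xor_ (E.member j) (side-S i)))

    same-side : ∀ {u v b} → r u ≡ b → r v ≡ b → ¬ Adj G u v
    same-side {b = b} p q a with trans (sym (T⇒≡ a)) (trans (complete _ _) (trans (cong₂ _xor_ p q) (xor-same b)))
    ... | ()

    other-side : ∀ {u v} → Adj G u v → r v ≡ not (r u)
    other-side {u} {v} a = flip (r u) (r v) (trans (sym (complete u v)) (T⇒≡ a))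
      where
      flip : ∀ x y → x xor y ≡ true → y ≡ not x
      flip false true  _ = refl
      flip true  false _ = refl

    -- Two vertices of one part are not adjacent, so their rainbow path has a middle vertex in the
    -- other part, and there their rows of colours differ.
    RCWith2⇒T≤ : RCWith G 2 → t ≤ 2 ^ s
    RCWith2⇒T≤ (c , joined) = distinctRows⇒≤ (λ j i → col (E.elem j) (S.elem i)) rows
      where
      open Colouring c
      rows : DistinctRows (λ j i → col (E.elem j) (S.elem i))
      rows j j' ne with joined (E.elem j) (E.elem j')
      ... | vs , path with rainbow-short c _ _ vs path
      ...   | trivial e = ⊥-elim (ne (E.injective j j' e))
      ...   | direct a  = ⊥-elim (same-side (E.member j) (E.member j') a)
      ...   | via w a a' d with S.index w (cong not (trans (other-side a) (cong not (E.member j))))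
      ...     | i , refl = i , λ e → d (trans e (sym (colSym _ _ a')))

    RCWith2⇒S≤ : RCWith G 2 → s ≤ 2 ^ t
    RCWith2⇒S≤ (c , joined) = distinctRows⇒≤ (λ i j → col (S.elem i) (E.elem j)) rows
      where
      open Colouring c
      rows : DistinctRows (λ i j → col (S.elem i) (E.elem j))
      rows i i' ne with joined (S.elem i) (S.elem i')
      ... | vs , path with rainbow-short c _ _ vs path
      ...   | trivial e = ⊥-elim (ne (S.injective i i' e))
      ...   | direct a  = ⊥-elim (same-side (side-S i) (side-S i') a)
      ...   | via w a a' d with E.index w (trans (other-side a) (cong not (side-S i)))
      ...     | j , refl = j , λ e → d (trans e (sym (colSym _ _ a')))

    module _ (M : Matrix t s) (rows : DistinctRows M) (cols : DistinctRows (transpose M)) where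

      Position : Fin n → Set
      Position u = (∃ λ i → S.elem i ≡ u) ⊎ (∃ λ j → E.elem j ≡ u)

      position : ∀ u → Position u
      position u with r u in e
      ... | false = inj₁ (S.index u (cong not e))
      ... | true  = inj₂ (E.index u e)

      colour : ∀ {u v} → Position u → Position v → Fin 2
      colour (inj₁ (i , _)) (inj₂ (j , _)) = M j i
      colour (inj₂ (j , _)) (inj₁ (i , _)) = M j i
      -- Vertices of the same part span no edge; the value is a placeholder.
      colour _              _              = zero

      colour-sym : ∀ {u v} (p : Position u) (q : Position v) → colour p q ≡ colour q p
      colour-sym (inj₁ _) (inj₁ _) = refl
      colour-sym (inj₁ _) (inj₂ _) = refl
      colour-sym (inj₂ _) (inj₁ _) = refl
      colour-sym (inj₂ _) (inj₂ _) = refl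

      colouring : Colouring G 2
      colouring = record { col = λ u v → colour (position u) (position v)
                         ; colSym = λ u v _ → colour-sym (position u) (position v) }

      S≢T : ∀ i j → S.elem i ≢ E.elem j
      S≢T i j = adj⇒≢ (adj-ST i j)

      -- Arbitrary positions are allowed because the index computed by `position` need not be `i` or
      -- `j` on the nose; injectivity of the enumerations identifies them.
      colour-ST : ∀ i j (p : Position (S.elem i)) (q : Position (E.elem j)) → colour p q ≡ M j i
      colour-ST i j (inj₂ (j' , e)) q               = ⊥-elim (S≢T i j' (sym e))
      colour-ST i j (inj₁ _)        (inj₁ (i' , e)) = ⊥-elim (S≢T i' j e)
      colour-ST i j (inj₁ (i' , e)) (inj₂ (j' , e')) = cong₂ M (E.injective j' j e') (S.injective i' i e)

      col-ST : ∀ i j → Colouring.col colouring (S.elem i) (E.elem j) ≡ M j i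
      col-ST i j = colour-ST i j (position (S.elem i)) (position (E.elem j))

      col-TS : ∀ i j → Colouring.col colouring (E.elem j) (S.elem i) ≡ M j i
      col-TS i j = trans (colour-sym (position (E.elem j)) (position (S.elem i))) (col-ST i j)

      joined-at : ∀ u v → u ≢ v → Position u → Position v → ∃ λ vs → RainbowPath G colouring u v vs
      joined-at _ _ ne (inj₁ (i , refl)) (inj₂ (j , refl)) = _ , path-two colouring _ _ (adj-ST i j)
      joined-at _ _ ne (inj₂ (j , refl)) (inj₁ (i , refl)) = _ , path-two colouring _ _ (adj-TS j i)
      joined-at _ _ ne (inj₁ (i , refl)) (inj₁ (i' , refl)) =
        let (j , d) = cols i i' (ne ∘ cong S.elem) in
        _ , path-three colouring _ (E.elem j) _ ne (adj-ST i j) (adj-TS j i')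
              (λ e → d (trans (sym (col-ST i j)) (trans e (col-TS i' j))))
      joined-at _ _ ne (inj₂ (j , refl)) (inj₂ (j' , refl)) =
        let (i , d) = rows j j' (ne ∘ cong E.elem) in
        _ , path-three colouring _ (S.elem i) _ ne (adj-TS j i) (adj-ST i j')
              (λ e → d (trans (sym (col-TS i j)) (trans e (col-ST i j'))))

      separating⇒RCWith2 : RCWith G 2
      separating⇒RCWith2 = colouring , joined
        where
        joined : RainbowConnected G colouring
        joined u v with u Fin.≟ v
        ... | yes refl = _ , path-one colouring u
        ... | no u≢v   = joined-at u v u≢v (position u) (position v)

    -- One colour joins only adjacent vertices, and among three vertices two lie in the same part.
    -- With zero colours, `col` at any vertex would be an element of `Fin 0`.
    not-fewer : 2 < n → ∀ k → k < 2 → ¬ RCWith G k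
    not-fewer n>2 zero k<2 (c , _) with Colouring.col c (fromℕ< n>2) (fromℕ< n>2)
    ... | ()
    not-fewer n>2 (suc (suc k)) (s≤s (s≤s ())) _
    not-fewer n>2 (suc zero) k<2 (c , joined) = pigeonhole (r x) (r y) (r z) refl refl refl
      where
      n>0 : 0 < n
      n>0 = ≤-trans (s≤s z≤n) n>2
      n>1 : 1 < n
      n>1 = ≤-trans (s≤s (s≤s z≤n)) n>2
      x y z : Fin n
      x = fromℕ< n>0
      y = fromℕ< n>1
      z = fromℕ< n>2
      apart : ∀ {a b} (p : a < n) (q : b < n) → a ≢ b → fromℕ< p ≢ fromℕ< q
      apart p q ne e = ne (trans (sym (toℕ-fromℕ< p)) (trans (cong toℕ e) (toℕ-fromℕ< q)))
      x≢y = apart n>0 n>1 λ ()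
      x≢z = apart n>0 n>2 λ ()
      y≢z = apart n>1 n>2 λ ()
      clash : ∀ {u v b} → u ≢ v → r u ≡ b → r v ≡ b → ⊥
      clash {u} {v} ne p q with rainbow-one c u v _ (proj₂ (joined u v))
      ... | inj₁ e = ne e
      ... | inj₂ a = same-side p q a
      pigeonhole : ∀ a b d → r x ≡ a → r y ≡ b → r z ≡ d → ⊥
      pigeonhole false false _     p q _ = clash x≢y p q
      pigeonhole true  true  _     p q _ = clash x≢y p q
      pigeonhole false true  false p _ q = clash x≢z p q
      pigeonhole true  false true  p _ q = clash x≢z p q
      pigeonhole false true  true  _ p q = clash y≢z p q
      pigeonhole true  false false _ p q = clash y≢z p q

    balanced⇒rc≡2 : 2 < n → t ≤ 2 ^ s → s ≤ 2 ^ t → rc≡ G 2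
    balanced⇒rc≡2 n>2 t≤ s≤ = let (M , rows , cols) = separating t s t≤ s≤ in
      separating⇒RCWith2 M rows cols , not-fewer n>2

-- Acceptance of the encoding and rc(G) = 2

module Accepting (G : Graph) (nontrivial : Nontrivial G) where
  open Graph G

  private
    xs : List Bool
    xs = encode G

  r : Fin n → Bool
  r = nth xs ∘ toℕ

  open Decide xs n nontrivial (sym (length-encode G))

  origin : Fin n
  origin = fromℕ< n>0

  r≡adj : ∀ v → r v ≡ adj origin v
  r≡adj v = trans (cong (λ z → nth xs (z * n + toℕ v)) (sym (toℕ-fromℕ< n>0))) (nth-encode G origin v)

  private
    S = enumerate n (not ∘ nth xs)
    E = enumerate n (nth xs)

  rankOne⇒complete : RankOne xs n (length xs) → CompleteBipartite G r
  rankOne⇒complete h u v = trans (sym (nth-encode G u v)) (h (toℕ u) (toℕ v) (toℕ<n v)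
    (≤-trans (≤-trans (+-monoʳ-< (toℕ u * n) (toℕ<n v)) (≤-reflexive (+-comm (toℕ u * n) n)))
             (≤-trans (*-monoˡ-≤ n (toℕ<n u)) (≤-reflexive (sym (length-encode G))))))

  complete⇒rankOne : CompleteBipartite G r → RankOne xs n (length xs)
  complete⇒rankOne h u v v<n uv<L =
    subst₂ (λ u v → nth xs (u * n + v) ≡ nth xs u xor nth xs v) (toℕ-fromℕ< u<n) (toℕ-fromℕ< v<n)
      (trans (nth-encode G (fromℕ< u<n) (fromℕ< v<n)) (h (fromℕ< u<n) (fromℕ< v<n)))
    where
    u<n : u < n
    u<n = *-cancelʳ-< n u n (≤-<-trans (m≤m+n (u * n) v) (<-≤-trans uv<L (≤-reflexive (length-encode G))))

  accept⇒rc≡2 : Accept → rc≡ G 2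
  accept⇒rc≡2 (rank , n≢2 , t≤ , s≤) =
    balanced⇒rc≡2 G r (rankOne⇒complete rank) S E (≤∧≢⇒< nontrivial (n≢2 ∘ sym)) t≤ s≤

  rc≡2⇒accept : Connected G → Bipartite G → rc≡ G 2 → Accept
  rc≡2⇒accept conn bip h@(rcw , _) = complete⇒rankOne complete , rc≡2⇒n≢2 G conn h ,
    RCWith2⇒T≤ G r complete S E rcw , RCWith2⇒S≤ G r complete S E rcw
    where
    complete : CompleteBipartite G r
    complete u v = trans (rc≡2⇒complete G bip rcw origin u v) (sym (cong₂ _xor_ (r≡adj u) (r≡adj v)))

decide : List Bool → Bool
decide xs = verdict rans rzero (Semantics.sem xs decider (replicate 16 0))

Correct : (List Bool → Bool) → Set
Correct f = ∀ (G : Graph) → Nontrivial G → Connected G → Bipartite G →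
  (f (encode G) ≡ true → rc≡ G 2) × (rc≡ G 2 → f (encode G) ≡ true)

decide-correct : Correct decide
decide-correct G nontrivial conn bip =
  (accept⇒rc≡2 ∘ outcome-sound decider-correct) , (outcome-complete decider-correct ∘ rc≡2⇒accept conn bip)
  where
  open Accepting G nontrivial
  open Decide (encode G) (Graph.n G) nontrivial (sym (length-encode G))

encode-nonempty : ∀ G → Nontrivial G → 0 < length (encode G)
encode-nonempty G nontrivial = Decide.L>0 (encode G) (Graph.n G) nontrivial (sym (length-encode G))

-- Abstracting over f keeps the compiled machine folded during conversion checking.
correct⇒theorem : ∀ f → Correct f → PolyTime f → Σ TM λ M → Σ ℕ λ c → Σ ℕ λ d →
    ∀ (G : Graph) → Nontrivial G → Connected G → Bipartite G →
    Σ Bool λ b →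
    run M (c * suc (length (encode G)) ^ d) (initial M (encode G)) ≡ just b
    × (b ≡ true → rc≡ G 2) × (rc≡ G 2 → b ≡ true)
correct⇒theorem f correct (M , c , d , runs) = M , c , d , λ G nontrivial conn bip →
  f (encode G) , runs (encode G) (encode-nonempty G nontrivial) , correct G nontrivial conn bip

theorem3 : Σ TM λ M → Σ ℕ λ c → Σ ℕ λ d →
    ∀ (G : Graph) → Nontrivial G → Connected G → Bipartite G →
    Σ Bool λ b →
    run M (c * suc (length (encode G)) ^ d) (initial M (encode G)) ≡ just b
    × (b ≡ true → rc≡ G 2) × (rc≡ G 2 → b ≡ true)
theorem3 = correct⇒theorem decide decide-correct (program-polyTime decider decider-wf rans rzero)
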